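{- (i) Let $I,J$ be sets and $R\colon I\times J\to[0,1]$ a fuzzy relation. Then the mappings $f_R\colon[0,1]^I\to[0,1]^J$ and $g_R\colon[0,1]^J\to[0,1]^I$ satisfy $f_R\leftrightarrows g_R$ (as maps between the power Pavelka algebras $[0,1]^I$ and $[0,1]^J$). (ii) Let $\mathbf A$ and $\mathbf B$ be semisimple Pavelka algebras and let $f\colon A\to B$, $g\colon B\to A$ satisfy $f\leftrightarrows g$. Then there exists a fuzzy relation $R\colon \mathrm{Spec_M}\mathbf A\times\mathrm{Spec_M}\mathbf B\to[0,1]$ (namely $R(F,G)=\bigwedge_{a\in A}(f(a)/G\rightarrow a/F)$) such that $n_{\mathbf B}(f(x))=f_R(n_{\mathbf A}(x))$ for all $x\in A$ and $n_{\mathbf A}(g(y))=g_R(n_{\mathbf B}(y))$ for all $y\in B$, where $f_R,g_R$ are taken with $I=\mathrm{Spec_M}\mathbf A$, $J=\mathrm{Spec_M}\mathbf B$.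
   Context: An MV-algebra $(A;\oplus,\neg,0)$ carries derived operations $1=\neg0$, $x\cdot y=\neg(\neg x\oplus\neg y)$, $x\rightarrow y=\neg x\oplus y$, $x\vee y=\neg(\neg x\oplus y)\oplus y$, $x\wedge y=\neg(\neg x\vee\neg y)$, and order $x\le y$ iff $\neg x\oplus y=1$. The standard MV-algebra is $[0,1]$ with $x\oplus y=\min\{x+y,1\}$, $\neg x=1-x$ (so $x\cdot y=\max\{0,x+y-1\}$, $x\rightarrow y=\min\{1,1-x+y\}$). A Pavelka algebra is $\mathbf A=(A;\oplus,\neg,\{\mathbf r\mid r\in[0,1]\cap\mathbb Q\})$ with $(A;\oplus,\neg,\mathbf 0)$ an MV-algebra, $\mathbf r\oplus\mathbf s=\mathbf t$ whenever $\min\{r+s,1\}=t$, and $\neg\mathbf r=\mathbf s$ whenever $1-r=s$. The standard Pavelka algebra is $[0,1]$ with $\mathbf r$ interpreted as $r$; $[0,1]^I$ is its power (componentwise, constants diagonal). A filter of a Pavelka algebra is a filter of its MV-reduct (a nonempty up-set closed under $\cdot$); a maximal filter is a maximal proper filter; $\mathrm{Spec_M}\mathbf A$ is the set of maximal filters. For $F\in\mathrm{Spec_M}\mathbf A$ the quotient $\mathbf A/F$ embeds uniquely into the standard Pavelka algebra and $x/F$ is identified with its image in $[0,1]$. $\mathbf A$ is semisimple if its MV-reduct is a subdirect product of simple MV-algebras. The natural embedding is $n_{\mathbf A}\colon A\to[0,1]^{\mathrm{Spec_M}\mathbf A}$, $n_{\mathbf A}(x)(F)=x/F$. For Pavelka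 algebras $\mathbf A,\mathbf B$ and maps $f\colon A\to B$, $g\colon B\to A$: $f\leftrightarrows g$ ($f$ is a strong left adjoint of $g$) means that $f,g$ are monotone, $x\le f(y)$ iff $g(x)\le y$ for all $y\in A$, $x\in B$, and $\mathbf r\rightarrow f(x)=f(\mathbf r\rightarrow x)$ for all $x\in A$ and all constants $\mathbf r$ (equivalently $\mathbf r\cdot g(y)=g(\mathbf r\cdot y)$ for all $y\in B$ and constants $\mathbf r$). For $R\colon I\times J\to[0,1]$: $f_R(x)(j)=\bigwedge_{i\in I}(R(i,j)\rightarrow x(i))$ for $x\in[0,1]^I$, $j\in J$; $g_R(y)(i)=\bigvee_{j\in J}(R(i,j)\cdot y(j))$ for $y\in[0,1]^J$, $i\in I$ (operations of the standard MV-algebra). -}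

module Defs where

open import Algebra.Core using (Op₁; Op₂)
open import Algebra.Definitions using (Involutive; RightZero; Congruent₁; Congruent₂)
open import Algebra.Structures using (IsCommutativeMonoid)
open import Axiom.ExcludedMiddle using (ExcludedMiddle)
open import Data.Empty using (⊥-elim)
import Data.Integer.Base as ℤ
import Data.Integer.Properties as ℤ
open import Data.Nat.Base as ℕ using (ℕ)
import Data.Nat.Properties as ℕ
open import Data.Product using (Σ-syntax; ∃; ∃-syntax; _×_; _,_; proj₁; proj₂)
import Data.Rational as ℚ
open ℚ using (ℚ; 0ℚ; 1ℚ; _<_; _+_; _-_)
import Data.Rational.Properties as ℚ
open import Data.Rational.Solver using (module +-*-Solver)
import Data.Rational.Unnormalised as ℚᵘ
import Data.Rational.Unnormalised.Properties as ℚᵘ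
open import Data.Sum.Base using (_⊎_; inj₁; inj₂)
open import Function.Base using (_∘_)
open import Function.Bundles using (_⇔_)
open import Function.Definitions using (Congruent; Injective; Surjective)
open import Level using (Level; _⊔_; suc; Lift; lift; lower)
open import Relation.Binary using (Rel; IsEquivalence; Poset; tri<; tri≈; tri>)
import Relation.Binary as Binary using (_⇒_)
import Relation.Binary.Reasoning.Setoid as SetoidReasoning
open import Relation.Binary.PropositionalEquality as ≡ using (_≡_; refl)
open import Relation.Nullary using (¬_; yes; no)
open import Relation.Nullary.Decidable using (decidable-stable)
open import Relation.Unary using (Pred; _∈_; _∉_; _⊆_; Satisfiable)

private variable
  a c c′ ℓ ℓ′ : Level

record RawMVAlgebra c ℓ : Set (suc (c ⊔ ℓ)) where
  infix  8 ∼_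
  infixl 7 _·_
  infixl 6 _⊕_ _∨_ _∧_
  infixr 5 _⇒_
  infix  4 _≈_ _≤_
  field
    Carrier : Set c
    _≈_     : Rel Carrier ℓ
    _⊕_     : Op₂ Carrier
    ∼_      : Op₁ Carrier
    𝟘       : Carrier

  𝟙 : Carrier
  𝟙 = ∼ 𝟘

  _·_ _⇒_ _∨_ _∧_ : Op₂ Carrier
  x · y = ∼ (∼ x ⊕ ∼ y)
  x ⇒ y = ∼ x ⊕ y
  x ∨ y = ∼ (∼ x ⊕ y) ⊕ y
  x ∧ y = ∼ (∼ x ∨ ∼ y)

  _≤_ : Rel Carrier ℓ
  x ≤ y = ∼ x ⊕ y ≈ 𝟙

record IsMVAlgebra (M : RawMVAlgebra c ℓ) : Set (c ⊔ ℓ) where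
  open RawMVAlgebra M
  field
    ⊕-isCommutativeMonoid : IsCommutativeMonoid _≈_ _⊕_ 𝟘
    ∼-cong                : Congruent₁ _≈_ ∼_
    ∼-involutive          : Involutive _≈_ ∼_
    ⊕-zeroʳ               : RightZero _≈_ 𝟙 _⊕_
    ∨-comm                : ∀ x y → x ∨ y ≈ y ∨ x

record MVAlgebra c ℓ : Set (suc (c ⊔ ℓ)) where
  field
    rawMVAlgebra : RawMVAlgebra c ℓ
    isMVAlgebra  : IsMVAlgebra rawMVAlgebra
  open RawMVAlgebra rawMVAlgebra public
  open IsMVAlgebra isMVAlgebra public

ℚ₀₁ : Set
ℚ₀₁ = Σ[ r ∈ ℚ ] 0ℚ ℚ.≤ r × r ℚ.≤ 1ℚ

0₀₁ : ℚ₀₁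
0₀₁ = 0ℚ , ℚ.≤-refl , ℚ.nonNegative⁻¹ 1ℚ

record RawPavelkaAlgebra c ℓ : Set (suc (c ⊔ ℓ)) where
  infix  8 ∼_
  infixl 6 _⊕_
  infix  4 _≈_
  field
    Carrier : Set c
    _≈_     : Rel Carrier ℓ
    _⊕_     : Op₂ Carrier
    ∼_      : Op₁ Carrier
    const   : ℚ₀₁ → Carrier

  rawMVAlgebra : RawMVAlgebra c ℓ
  rawMVAlgebra = record
    { Carrier = Carrier ; _≈_ = _≈_ ; _⊕_ = _⊕_ ; ∼_ = ∼_ ; 𝟘 = const 0₀₁ }

  open RawMVAlgebra rawMVAlgebra public
    using (𝟘; 𝟙; _·_; _⇒_; _∨_; _∧_; _≤_)

record IsPavelkaAlgebra (P : RawPavelkaAlgebra c ℓ) : Set (c ⊔ ℓ) where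
  open RawPavelkaAlgebra P
  field
    isMVAlgebra : IsMVAlgebra rawMVAlgebra
    const-⊕     : ∀ r s t → (proj₁ r + proj₁ s) ℚ.⊓ 1ℚ ≡ proj₁ t →
                  const r ⊕ const s ≈ const t
    const-∼     : ∀ r s → 1ℚ - proj₁ r ≡ proj₁ s → ∼ const r ≈ const s

record PavelkaAlgebra c ℓ : Set (suc (c ⊔ ℓ)) where
  field
    rawPavelkaAlgebra : RawPavelkaAlgebra c ℓ
    isPavelkaAlgebra  : IsPavelkaAlgebra rawPavelkaAlgebra
  open RawPavelkaAlgebra rawPavelkaAlgebra public
  open IsPavelkaAlgebra isPavelkaAlgebra public

  mvAlgebra : MVAlgebra c ℓ
  mvAlgebra = record { rawMVAlgebra = rawMVAlgebra ; isMVAlgebra = isMVAlgebra }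

record IsMVMonomorphism (M : RawMVAlgebra c ℓ) (N : RawMVAlgebra c′ ℓ′)
    (h : RawMVAlgebra.Carrier M → RawMVAlgebra.Carrier N) : Set (c ⊔ ℓ ⊔ ℓ′) where
  private
    module M = RawMVAlgebra M
    module N = RawMVAlgebra N
  field
    cong      : Congruent M._≈_ N._≈_ h
    ⊕-homo    : ∀ x y → h (x M.⊕ y) N.≈ h x N.⊕ h y
    ∼-homo    : ∀ x → h (M.∼ x) N.≈ N.∼ h x
    𝟘-homo    : h M.𝟘 N.≈ N.𝟘
    injective : Injective M._≈_ N._≈_ h

record IsPavelkaMonomorphism (P : RawPavelkaAlgebra c ℓ) (Q : RawPavelkaAlgebra c′ ℓ′)
    (h : RawPavelkaAlgebra.Carrier P → RawPavelkaAlgebra.Carrier Q) : Set (c ⊔ ℓ ⊔ ℓ′) where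
  private
    module P = RawPavelkaAlgebra P
    module Q = RawPavelkaAlgebra Q
  field
    isMVMonomorphism : IsMVMonomorphism P.rawMVAlgebra Q.rawMVAlgebra h
    const-homo       : ∀ r → h (P.const r) Q.≈ Q.const r
  open IsMVMonomorphism isMVMonomorphism public

∏ : {I : Set a} → (I → RawMVAlgebra c ℓ) → RawMVAlgebra (a ⊔ c) (a ⊔ ℓ)
∏ {I = I} M = record
  { Carrier = ∀ i → M.Carrier i
  ; _≈_     = λ x y → ∀ i → M._≈_ i (x i) (y i)
  ; _⊕_     = λ x y i → M._⊕_ i (x i) (y i)
  ; ∼_      = λ x i → M.∼_ i (x i)
  ; 𝟘       = λ i → M.𝟘 i
  } where module M i = RawMVAlgebra (M i)

record IsMVCongruence (M : RawMVAlgebra c ℓ)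
    (θ : Rel (RawMVAlgebra.Carrier M) ℓ′) : Set (c ⊔ ℓ ⊔ ℓ′) where
  open RawMVAlgebra M
  field
    isEquivalence : IsEquivalence θ
    reflexive     : _≈_ Binary.⇒ θ
    ⊕-cong        : Congruent₂ θ _⊕_
    ∼-cong        : Congruent₁ θ ∼_

record IsSimple (M : MVAlgebra c ℓ) : Set (suc (c ⊔ ℓ)) where
  open MVAlgebra M
  field
    nontrivial  : ¬ 𝟘 ≈ 𝟙
    congruences : (θ : Rel Carrier (c ⊔ ℓ)) → IsMVCongruence rawMVAlgebra θ →
                  (∀ x y → θ x y → x ≈ y) ⊎ (∀ x y → θ x y)

-- The MV-reduct is a subdirect product of simple MV-algebras.  The universe
-- levels of the index set and of the factors accommodate the family of all
-- quotients modulo maximal filters.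
record Semisimple (A : PavelkaAlgebra c ℓ) : Set (suc (suc (c ⊔ ℓ))) where
  private module A = PavelkaAlgebra A
  field
    Index      : Set (suc (c ⊔ ℓ))
    factor     : Index → MVAlgebra c (c ⊔ ℓ)
    simple     : ∀ i → IsSimple (factor i)
    embedding  : A.Carrier → ∀ i → MVAlgebra.Carrier (factor i)
    isEmbedding : IsMVMonomorphism A.rawMVAlgebra
                    (∏ (λ i → MVAlgebra.rawMVAlgebra (factor i))) embedding
    projection-surjective : ∀ i →
      Surjective A._≈_ (MVAlgebra._≈_ (factor i)) (λ x → embedding x i)

module MVProperties (M : MVAlgebra c ℓ) where
  open MVAlgebra M
  open IsCommutativeMonoid ⊕-isCommutativeMonoid public
    using (isEquivalence; setoid)
    renaming (refl to ≈-refl; sym to ≈-sym; trans to ≈-trans;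
              ∙-cong to ⊕-cong; assoc to ⊕-assoc; comm to ⊕-comm;
              identityˡ to ⊕-identityˡ; identityʳ to ⊕-identityʳ)
  open SetoidReasoning setoid

  ∼𝟙≈𝟘 : ∼ 𝟙 ≈ 𝟘
  ∼𝟙≈𝟘 = ∼-involutive 𝟘

  ⊕-congˡ : ∀ {x y z} → y ≈ z → x ⊕ y ≈ x ⊕ z
  ⊕-congˡ = ⊕-cong ≈-refl

  ⊕-congʳ : ∀ {x y z} → y ≈ z → y ⊕ x ≈ z ⊕ x
  ⊕-congʳ p = ⊕-cong p ≈-refl

  𝟙⇒x≈x : ∀ x → 𝟙 ⇒ x ≈ x
  𝟙⇒x≈x x = ≈-trans (⊕-congʳ ∼𝟙≈𝟘) (⊕-identityˡ x)

  ≤-refl : ∀ {x} → x ≤ x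
  ≤-refl {x} = begin
    ∼ x ⊕ x               ≈⟨ ⊕-congʳ (∼-cong (𝟙⇒x≈x x)) ⟨
    ∼ (𝟙 ⇒ x) ⊕ x         ≈⟨ ∨-comm 𝟙 x ⟩
    ∼ (∼ x ⊕ 𝟙) ⊕ 𝟙       ≈⟨ ⊕-zeroʳ _ ⟩
    𝟙                     ∎

  ≤-reflexive : ∀ {x y} → x ≈ y → x ≤ y
  ≤-reflexive x≈y = ≈-trans (⊕-congˡ (≈-sym x≈y)) ≤-refl

  ≤⇒∨≈ : ∀ {x y} → x ≤ y → x ∨ y ≈ y
  ≤⇒∨≈ {x} {y} x≤y = ≈-trans (⊕-congʳ (∼-cong x≤y)) (𝟙⇒x≈x y)

  ≤-antisym : ∀ {x y} → x ≤ y → y ≤ x → x ≈ y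
  ≤-antisym {x} {y} x≤y y≤x =
    ≈-trans (≈-sym (≤⇒∨≈ y≤x)) (≈-trans (∨-comm y x) (≤⇒∨≈ x≤y))

  x≤x⊕y : ∀ x y → x ≤ x ⊕ y
  x≤x⊕y x y = begin
    ∼ x ⊕ (x ⊕ y)  ≈⟨ ⊕-assoc _ _ _ ⟨
    ∼ x ⊕ x ⊕ y    ≈⟨ ⊕-congʳ ≤-refl ⟩
    𝟙 ⊕ y          ≈⟨ ⊕-comm 𝟙 y ⟩
    y ⊕ 𝟙          ≈⟨ ⊕-zeroʳ y ⟩
    𝟙              ∎

  x≤y⇒x : ∀ x y → x ≤ y ⇒ x
  x≤y⇒x x y = ≈-trans (⊕-congˡ (⊕-comm (∼ y) x)) (x≤x⊕y x (∼ y))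

  x≤𝟙 : ∀ x → x ≤ 𝟙
  x≤𝟙 x = ⊕-zeroʳ (∼ x)

  𝟘≤x : ∀ x → 𝟘 ≤ x
  𝟘≤x x = ≈-trans (⊕-comm 𝟙 x) (⊕-zeroʳ x)

  -- y = x ⊕ w for w = ¬(y → x) when x ≤ y
  ≤⇒⊕ : ∀ {x y} → x ≤ y → x ⊕ ∼ (y ⇒ x) ≈ y
  ≤⇒⊕ {x} {y} x≤y = ≈-trans (⊕-comm _ _) (≈-trans (∨-comm y x) (≤⇒∨≈ x≤y))

  ≤-trans : ∀ {x y z} → x ≤ y → y ≤ z → x ≤ z
  ≤-trans {x} {y} {z} x≤y y≤z = begin
    ∼ x ⊕ z                    ≈⟨ ⊕-congˡ (≤⇒⊕ y≤z) ⟨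
    ∼ x ⊕ (y ⊕ ∼ (z ⇒ y))      ≈⟨ ⊕-assoc _ _ _ ⟨
    ∼ x ⊕ y ⊕ ∼ (z ⇒ y)        ≈⟨ ⊕-congʳ x≤y ⟩
    𝟙 ⊕ ∼ (z ⇒ y)              ≈⟨ ⊕-comm _ _ ⟩
    ∼ (z ⇒ y) ⊕ 𝟙              ≈⟨ ⊕-zeroʳ _ ⟩
    𝟙                          ∎

  contraposition : ∀ x y → ∼ y ⇒ ∼ x ≈ x ⇒ y
  contraposition x y = ≈-trans (⊕-congʳ (∼-involutive y)) (⊕-comm y (∼ x))

  curry : ∀ x y z → x · y ⇒ z ≈ x ⇒ y ⇒ z
  curry x y z = ≈-trans (⊕-congʳ (∼-involutive _)) (⊕-assoc _ _ _)

  residual : ∀ {x y z} → x · y ≤ z → x ≤ y ⇒ z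
  residual {x} {y} {z} = ≈-trans (≈-sym (curry x y z))

  unresidual : ∀ {x y z} → x ≤ y ⇒ z → x · y ≤ z
  unresidual {x} {y} {z} = ≈-trans (curry x y z)

  ·-comm : ∀ x y → x · y ≈ y · x
  ·-comm x y = ∼-cong (⊕-comm _ _)

  ·-⇒ : ∀ x y → (x ⇒ y) · x ≤ y
  ·-⇒ x y = unresidual ≤-refl

  ·-monoˡ : ∀ {x y} z → x ≤ y → x · z ≤ y · z
  ·-monoˡ z x≤y = unresidual (≤-trans x≤y (residual ≤-refl))

  ·-assoc : ∀ x y z → (x · y) · z ≈ x · (y · z)
  ·-assoc x y z = ∼-cong (begin
    ∼ ∼ (∼ x ⊕ ∼ y) ⊕ ∼ z   ≈⟨ ⊕-congʳ (∼-involutive _) ⟩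
    ∼ x ⊕ ∼ y ⊕ ∼ z         ≈⟨ ⊕-assoc _ _ _ ⟩
    ∼ x ⊕ (∼ y ⊕ ∼ z)       ≈⟨ ⊕-congˡ (∼-involutive _) ⟨
    ∼ x ⊕ ∼ ∼ (∼ y ⊕ ∼ z)   ∎)

  ⇒-monoʳ : ∀ {x y} z → x ≤ y → z ⇒ x ≤ z ⇒ y
  ⇒-monoʳ z x≤y = residual (≤-trans (·-⇒ z _) x≤y)

  ⇒-antiˡ : ∀ {x y} z → x ≤ y → y ⇒ z ≤ x ⇒ z
  ⇒-antiˡ {x} {y} z x≤y = residual (≤-trans (≤-reflexive (·-comm _ x))
    (≤-trans (·-monoˡ _ x≤y) (≤-trans (≤-reflexive (·-comm y _)) (·-⇒ y z))))

  ⇒-trans : ∀ x y z → (y ⇒ z) · (x ⇒ y) ≤ x ⇒ z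
  ⇒-trans x y z = residual (≤-trans (≤-reflexive (·-assoc _ _ _))
    (≤-trans (≤-reflexive (·-comm _ _)) (≤-trans (·-monoˡ _ (·-⇒ x y))
    (≤-trans (≤-reflexive (·-comm _ _)) (·-⇒ y z)))))

  ⇒-⊕ : ∀ x y z → x ⇒ y ≤ x ⊕ z ⇒ y ⊕ z
  ⇒-⊕ x y z = residual (≤-trans
    (≤-reflexive (∼-cong (⊕-congˡ (∼-cong (≈-trans (⊕-comm x z) (⊕-congʳ (≈-sym (∼-involutive z))))))))
    (≤-trans (⇒-trans (∼ z) x y)
    (≤-reflexive (≈-trans (⊕-congʳ (∼-involutive z)) (⊕-comm z y)))))

  divisibility : ∀ x y → (x ⇒ y) · x ≈ (y ⇒ x) · y
  divisibility x y = ∼-cong (begin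
    ∼ (∼ x ⊕ y) ⊕ ∼ x          ≈⟨ ⊕-congʳ (∼-cong (contraposition x y)) ⟨
    ∼ (∼ ∼ y ⊕ ∼ x) ⊕ ∼ x      ≈⟨ ∨-comm (∼ y) (∼ x) ⟩
    ∼ (∼ ∼ x ⊕ ∼ y) ⊕ ∼ y      ≈⟨ ⊕-congʳ (∼-cong (contraposition y x)) ⟩
    ∼ (∼ y ⊕ x) ⊕ ∼ y          ∎)

  exchange : ∀ x y z → x ⇒ y ⇒ z ≈ y ⇒ x ⇒ z
  exchange x y z = begin
    ∼ x ⊕ (∼ y ⊕ z)  ≈⟨ ⊕-assoc _ _ _ ⟨
    ∼ x ⊕ ∼ y ⊕ z    ≈⟨ ⊕-congʳ (⊕-comm _ _) ⟩
    ∼ y ⊕ ∼ x ⊕ z    ≈⟨ ⊕-assoc _ _ _ ⟩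
    ∼ y ⊕ (∼ x ⊕ z)  ∎

  -- (x → y) ∨ (y → x) = 1
  prelinearity : ∀ x y → (x ⇒ y) ⇒ (y ⇒ x) ≤ y ⇒ x
  prelinearity x y = residual (≤-trans (≤-reflexive (begin
      ((x ⇒ y) ⇒ (y ⇒ x)) · y   ≈⟨ ∼-cong (⊕-congʳ (∼-cong (exchange _ _ _))) ⟩
      (y ⇒ z) · y               ≈⟨ divisibility y z ⟩
      (z ⇒ y) · z               ∎))
    (≤-trans (·-monoˡ z (⇒-antiˡ y (x≤y⇒x x (x ⇒ y))))
    (≤-trans (≤-reflexive (·-comm (x ⇒ y) z)) (·-⇒ (x ⇒ y) x))))
    where z = (x ⇒ y) ⇒ x

  infixr 8 _^_
  _^_ : Carrier → ℕ → Carrier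
  x ^ ℕ.zero  = 𝟙
  x ^ ℕ.suc n = x · x ^ n

  ^-prelinear : ∀ {x y} n → x ⇒ y ≤ y → x ^ n ⇒ y ≤ y
  ^-prelinear {y = y} ℕ.zero    x⇒y≤y = ≤-reflexive (𝟙⇒x≈x y)
  ^-prelinear {x} {y} (ℕ.suc n) x⇒y≤y = ≤-trans
    (≤-trans (≤-reflexive (curry x (x ^ n) y)) (⇒-monoʳ x (^-prelinear n x⇒y≤y))) x⇒y≤y

  ^-+ : ∀ x m n → x ^ m · x ^ n ≈ x ^ (m ℕ.+ n)
  ^-+ x ℕ.zero    n = ≈-trans (∼-cong (𝟙⇒x≈x _)) (∼-involutive _)
  ^-+ x (ℕ.suc m) n = ≈-trans (·-assoc _ _ _) (∼-cong (⊕-congˡ (∼-cong (^-+ x m n))))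

module _ (A : PavelkaAlgebra c ℓ) where
  open PavelkaAlgebra A

  record IsFilter (F : Pred Carrier (c ⊔ ℓ)) : Set (c ⊔ ℓ) where
    field
      nonempty : Satisfiable F
      upward   : ∀ {x y} → x ≤ y → x ∈ F → y ∈ F
      ·-closed : ∀ {x y} → x ∈ F → y ∈ F → (x · y) ∈ F

  record IsProperFilter (F : Pred Carrier (c ⊔ ℓ)) : Set (c ⊔ ℓ) where
    field
      isFilter : IsFilter F
      proper   : ¬ (∀ x → x ∈ F)
    open IsFilter isFilter public

  -- Extensionally equal filters are not identified; this does not affect
  -- infima and suprema indexed by SpecM.
  record SpecM : Set (suc (c ⊔ ℓ)) where
    field
      filter         : Pred Carrier (c ⊔ ℓ)
      isProperFilter : IsProperFilter filter
      maximal        : ∀ {G} → IsProperFilter G → filter ⊆ G → G ⊆ filter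
    open IsProperFilter isProperFilter public

-- The quotient keeps the carrier and coarsens the equality.
_/_ : (A : PavelkaAlgebra c ℓ) → SpecM A → RawPavelkaAlgebra c (c ⊔ ℓ)
A / F = record
  { Carrier = Carrier
  ; _≈_     = λ x y → (x ⇒ y) ∈ filter × (y ⇒ x) ∈ filter
  ; _⊕_     = _⊕_
  ; ∼_      = ∼_
  ; const   = const
  } where open PavelkaAlgebra A; open SpecM F

-- A real number x ∈ [0,1] is given by its lower Dedekind cut { q ∈ ℚ ∣ q < x }.
-- One-sided cuts are an adequate notion of real number in the presence of
-- excluded middle; module Classical derives the Pavelka algebra laws from it.
record UnitInterval ℓ : Set (suc ℓ) where
  no-eta-equality
  field
    cut     : Pred ℚ ℓ
    0≤      : ∀ {q} → q < 0ℚ → q ∈ cut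
    ≤1      : ∀ {q} → q ∈ cut → q < 1ℚ
    downward : ∀ {q r} → q < r → r ∈ cut → q ∈ cut
    rounded : ∀ {q} → q ∈ cut → ∃[ r ] q < r × r ∈ cut

open UnitInterval public

infix 4 _◁_
_◁_ : ℚ → UnitInterval ℓ → Set ℓ
q ◁ x = q ∈ cut x

open +-*-Solver using (solve; _:=_; _:+_; _:-_; con)

abstract
  -- Linear arithmetic: p < q yields r < s whenever q - p = s - r.
  by : ∀ {p q r s} → p < q → q - p ≡ s - r → r < s
  by {p} {q} {r} {s} p<q eq =
    ≡.subst₂ _<_ (ℚ.+-identityˡ r) (solve 2 (λ s r → s :- r :+ r := s) refl s r)
      (ℚ.+-monoˡ-< r (≡.subst₂ _<_ (ℚ.+-inverseʳ p) eq (ℚ.+-monoˡ-< (ℚ.- p) p<q)))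

  by≤ : ∀ {p q r s} → p ℚ.≤ q → q - p ≡ s - r → r ℚ.≤ s
  by≤ {p} {q} {r} {s} p≤q eq =
    ≡.subst₂ ℚ._≤_ (ℚ.+-identityˡ r) (solve 2 (λ s r → s :- r :+ r := s) refl s r)
      (ℚ.+-monoˡ-≤ r (≡.subst₂ ℚ._≤_ (ℚ.+-inverseʳ p) eq (ℚ.+-monoˡ-≤ (ℚ.- p) p≤q)))

  dense : ∀ {p q} → p < q → ∃[ m ] p < m × m < q
  dense = ℚ.<-dense

0<1 : 0ℚ < 1ℚ
0<1 = ℚ.positive⁻¹ 1ℚ

<-⊓ : ∀ {p q r} → p < q → p < r → p < q ℚ.⊓ r
<-⊓ {p} {q} {r} p<q p<r with ℚ.⊓-sel q r
... | inj₁ eq rewrite eq = p<q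
... | inj₂ eq rewrite eq = p<r

⊔-< : ∀ {p q r} → p < r → q < r → p ℚ.⊔ q < r
⊔-< {p} {q} {r} p<r q<r with ℚ.⊔-sel p q
... | inj₁ eq rewrite eq = p<r
... | inj₂ eq rewrite eq = q<r

⟦_⟧ : ℚ₀₁ → UnitInterval ℓ
⟦ r , 0≤r , r≤1 ⟧ .cut q                  = Lift _ (q < r)
⟦ r , 0≤r , r≤1 ⟧ .0≤ q<0                 = lift (ℚ.<-≤-trans q<0 0≤r)
⟦ r , 0≤r , r≤1 ⟧ .≤1 (lift q<r)          = ℚ.<-≤-trans q<r r≤1
⟦ r , 0≤r , r≤1 ⟧ .downward p<q (lift q<r) = lift (ℚ.<-trans p<q q<r)
⟦ r , 0≤r , r≤1 ⟧ .rounded (lift q<r)     =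
  let s , q<s , s<r = dense q<r in s , q<s , lift s<r

infixl 6 _⊕ᵁ_
infix  8 ∼ᵁ_

-- The real number min (x + y) 1.
_⊕ᵁ_ : Op₂ (UnitInterval ℓ)
(x ⊕ᵁ y) .cut q = q < 1ℚ × ∃[ r ] ∃[ s ] r ◁ x × s ◁ y × q < r + s
(x ⊕ᵁ y) .0≤ {q} q<0 =
  let r , q<r , r<0 = dense q<0
      s , q-r<s , s<0 = dense {q - r} {0ℚ}
        (by q<r (solve 2 (λ q r → r :- q := con 0ℚ :- (q :- r)) refl q r))
  in ℚ.<-trans q<0 0<1 , r , s , 0≤ x r<0 , 0≤ y s<0 ,
     by q-r<s (solve 3 (λ q r s → s :- (q :- r) := r :+ s :- q) refl q r s)
(x ⊕ᵁ y) .≤1 = proj₁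
(x ⊕ᵁ y) .downward p<q (q<1 , r , s , r◁x , s◁y , q<r+s) =
  ℚ.<-trans p<q q<1 , r , s , r◁x , s◁y , ℚ.<-trans p<q q<r+s
(x ⊕ᵁ y) .rounded (q<1 , r , s , r◁x , s◁y , q<r+s) =
  let t , q<t , t<min = dense (<-⊓ q<r+s q<1)
  in t , q<t , ℚ.<-≤-trans t<min (ℚ.p⊓q≤q (r + s) 1ℚ) , r , s , r◁x , s◁y ,
     ℚ.<-≤-trans t<min (ℚ.p⊓q≤p (r + s) 1ℚ)

-- The real number 1 - x.
∼ᵁ_ : Op₁ (UnitInterval ℓ)
(∼ᵁ x) .cut q = ∃[ r ] q < r × ¬ 1ℚ - r ◁ x
(∼ᵁ x) .0≤ q<0 = 0ℚ , q<0 , λ 1◁x → ℚ.<-irrefl refl (≤1 x 1◁x)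
(∼ᵁ x) .≤1 (r , q<r , 1-r⋪x) = ℚ.<-≤-trans q<r (ℚ.≮⇒≥ λ 1<r → 1-r⋪x
  (0≤ x (by 1<r (solve 1 (λ r → r :- con 1ℚ := con 0ℚ :- (con 1ℚ :- r)) refl r))))
(∼ᵁ x) .downward p<q (r , q<r , 1-r⋪x) = r , ℚ.<-trans p<q q<r , 1-r⋪x
(∼ᵁ x) .rounded (r , q<r , 1-r⋪x) =
  let s , q<s , s<r = dense q<r in s , q<s , r , s<r , 1-r⋪x

-- q < inf x iff some rational r > q is below every x i; the clause r < 1
-- makes the empty infimum 1.
⋀ : {I : Set a} → (I → UnitInterval ℓ) → UnitInterval (a ⊔ ℓ)
⋀ x .cut q = ∃[ r ] q < r × r < 1ℚ × ∀ i → r ◁ x i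
⋀ x .0≤ q<0 =
  let r , q<r , r<0 = dense q<0 in r , q<r , ℚ.<-trans r<0 0<1 , λ i → 0≤ (x i) r<0
⋀ x .≤1 (r , q<r , r<1 , _) = ℚ.<-trans q<r r<1
⋀ x .downward p<q (r , q<r , r◁x) = r , ℚ.<-trans p<q q<r , r◁x
⋀ x .rounded (r , q<r , r◁x) =
  let s , q<s , s<r = dense q<r in s , q<s , r , s<r , r◁x

-- The clause q < 0 makes the empty supremum 0.
⋁ : {I : Set a} → (I → UnitInterval ℓ) → UnitInterval (a ⊔ ℓ)
⋁ x .cut q                           = q < 0ℚ ⊎ ∃[ i ] q ◁ x i
⋁ x .0≤                              = inj₁
⋁ x .≤1 (inj₁ q<0)                   = ℚ.<-trans q<0 0<1
⋁ x .≤1 (inj₂ (i , q◁x))             = ≤1 (x i) q◁x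
⋁ x .downward p<q (inj₁ q<0)         = inj₁ (ℚ.<-trans p<q q<0)
⋁ x .downward p<q (inj₂ (i , q◁x))   = inj₂ (i , downward (x i) p<q q◁x)
⋁ x .rounded (inj₁ q<0)              =
  let r , q<r , r<0 = dense q<0 in r , q<r , inj₁ r<0
⋁ x .rounded (inj₂ (i , q◁x))        =
  let r , q<r , r◁x = rounded (x i) q◁x in r , q<r , inj₂ (i , r◁x)

infix 4 _⊑_ _≈ᵁ_

_⊑_ : UnitInterval ℓ → UnitInterval ℓ′ → Set (ℓ ⊔ ℓ′)
x ⊑ y = ∀ {q} → q ◁ x → q ◁ y

record _≈ᵁ_ (x y : UnitInterval ℓ) : Set ℓ where
  constructor ⊑-antisym
  field
    ≈⇒⊑ : x ⊑ y
    ≈⇒⊒ : y ⊑ x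

open _≈ᵁ_ public

⋀-lower : {I : Set a} (x : I → UnitInterval ℓ) → ∀ i → ⋀ x ⊑ x i
⋀-lower x i (r , q<r , _ , r◁x) = downward (x i) q<r (r◁x i)

⋀-greatest : {I : Set a} (x : I → UnitInterval ℓ) (y : UnitInterval ℓ′) →
             (∀ i → y ⊑ x i) → y ⊑ ⋀ x
⋀-greatest x y y⊑x q◁y =
  let r , q<r , r◁y = rounded y q◁y in r , q<r , ≤1 y r◁y , λ i → y⊑x i r◁y

⋁-upper : {I : Set a} (x : I → UnitInterval ℓ) → ∀ i → x i ⊑ ⋁ x
⋁-upper x i q◁x = inj₂ (i , q◁x)

⋁-least : {I : Set a} (x : I → UnitInterval ℓ) (y : UnitInterval ℓ′) →
          (∀ i → x i ⊑ y) → ⋁ x ⊑ y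
⋁-least x y x⊑y (inj₁ q<0)       = 0≤ y q<0
⋁-least x y x⊑y (inj₂ (i , q◁x)) = x⊑y i q◁x

rawUnitInterval : ∀ ℓ → RawPavelkaAlgebra (suc ℓ) ℓ
rawUnitInterval ℓ = record
  { Carrier = UnitInterval ℓ
  ; _≈_     = _≈ᵁ_
  ; _⊕_     = _⊕ᵁ_
  ; ∼_      = ∼ᵁ_
  ; const   = ⟦_⟧
  }

𝟘ᵁ 𝟙ᵁ : UnitInterval ℓ
𝟘ᵁ = RawPavelkaAlgebra.𝟘 (rawUnitInterval _)
𝟙ᵁ = RawPavelkaAlgebra.𝟙 (rawUnitInterval _)

≈ᵁ-isEquivalence : IsEquivalence (_≈ᵁ_ {ℓ})
≈ᵁ-isEquivalence = record
  { refl  = ⊑-antisym (λ p → p) (λ p → p)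
  ; sym   = λ x≈y → ⊑-antisym (≈⇒⊒ x≈y) (≈⇒⊑ x≈y)
  ; trans = λ x≈y y≈z → ⊑-antisym (≈⇒⊑ y≈z ∘ ≈⇒⊑ x≈y) (≈⇒⊒ x≈y ∘ ≈⇒⊒ y≈z)
  }

infixr 5 _⇒ᵁ_
infixl 7 _·ᵁ_
_⇒ᵁ_ _·ᵁ_ : Op₂ (UnitInterval ℓ)
_⇒ᵁ_ = RawPavelkaAlgebra._⇒_ (rawUnitInterval _)
_·ᵁ_ = RawPavelkaAlgebra._·_ (rawUnitInterval _)

<1⇒◁𝟙 : ∀ {q} → q < 1ℚ → q ◁ 𝟙ᵁ {ℓ}
<1⇒◁𝟙 {q = q} q<1 = 1ℚ , q<1 , λ (lift 0<0) → ℚ.<-irrefl refl 0<0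

⊔-◁ : (x : UnitInterval ℓ) → ∀ {p q} → p ◁ x → q ◁ x → p ℚ.⊔ q ◁ x
⊔-◁ x {p} {q} p◁x q◁x with ℚ.⊔-sel p q
... | inj₁ eq rewrite eq = p◁x
... | inj₂ eq rewrite eq = q◁x

⊕ᵁ-mono : {x y u v : UnitInterval ℓ} → x ⊑ y → u ⊑ v → x ⊕ᵁ u ⊑ y ⊕ᵁ v
⊕ᵁ-mono x⊑y u⊑v (q<1 , r , s , r◁x , s◁u , q<r+s) =
  q<1 , r , s , x⊑y r◁x , u⊑v s◁u , q<r+s

∼ᵁ-anti : {x y : UnitInterval ℓ} → x ⊑ y → ∼ᵁ y ⊑ ∼ᵁ x
∼ᵁ-anti x⊑y (r , q<r , 1-r⋪y) = r , q<r , 1-r⋪y ∘ x⊑y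

⊕ᵁ-comm-⊑ : (x y : UnitInterval ℓ) → x ⊕ᵁ y ⊑ y ⊕ᵁ x
⊕ᵁ-comm-⊑ x y {q} (q<1 , r , s , r◁x , s◁y , q<r+s) =
  q<1 , s , r , s◁y , r◁x , ≡.subst (q <_) (ℚ.+-comm r s) q<r+s

⊕ᵁ-assoc-⊑ : (x y z : UnitInterval ℓ) → (x ⊕ᵁ y) ⊕ᵁ z ⊑ x ⊕ᵁ (y ⊕ᵁ z)
⊕ᵁ-assoc-⊑ x y z {q} (q<1 , u , t , (_ , r , s , r◁x , s◁y , u<r+s) , t◁z , q<u+t) =
  let m , q-1<m , m<0 = dense {q - 1ℚ} {0ℚ}
        (by q<1 (solve 1 (λ q → con 1ℚ :- q := con 0ℚ :- (q :- con 1ℚ)) refl q))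
  in step₁ m q-1<m (r ℚ.⊔ m) (ℚ.p≤p⊔q r m) (ℚ.p≤q⊔p r m) (⊔-◁ x r◁x (0≤ x m<0))
  where
  step₂ : ∀ r′ v → r′ ◁ x → q - r′ < v → v < (s + t) ℚ.⊓ 1ℚ → q ◁ x ⊕ᵁ (y ⊕ᵁ z)
  step₂ r′ v r′◁x q-r′<v v<min =
    q<1 , r′ , v , r′◁x ,
    (ℚ.<-≤-trans v<min (ℚ.p⊓q≤q (s + t) 1ℚ) , s , t , s◁y , t◁z ,
     ℚ.<-≤-trans v<min (ℚ.p⊓q≤p (s + t) 1ℚ)) ,
    by q-r′<v (solve 3 (λ q r′ v → v :- (q :- r′) := r′ :+ v :- q) refl q r′ v)

  step₁ : ∀ m → q - 1ℚ < m → ∀ r′ → r ℚ.≤ r′ → m ℚ.≤ r′ → r′ ◁ x → q ◁ x ⊕ᵁ (y ⊕ᵁ z)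
  step₁ m q-1<m r′ r≤r′ m≤r′ r′◁x =
    let v , q-r′<v , v<min = dense {q - r′} {(s + t) ℚ.⊓ 1ℚ} (<-⊓ {q = s + t} {1ℚ}
          (by (ℚ.+-mono-<-≤ (ℚ.+-mono-< q<u+t u<r+s) r≤r′)
            (solve 6 (λ q u t r s r′ → (u :+ t) :+ (r :+ s) :+ r′ :- (q :+ u :+ r)
                                         := s :+ t :- (q :- r′)) refl q u t r s r′))
          (by (ℚ.+-mono-<-≤ q-1<m m≤r′)
            (solve 3 (λ q m r′ → m :+ r′ :- (q :- con 1ℚ :+ m) := con 1ℚ :- (q :- r′))
              refl q m r′)))
    in step₂ r′ v r′◁x q-r′<v v<min

⊕ᵁ-assoc : (x y z : UnitInterval ℓ) → (x ⊕ᵁ y) ⊕ᵁ z ≈ᵁ x ⊕ᵁ (y ⊕ᵁ z)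
⊕ᵁ-assoc x y z = ⊑-antisym (⊕ᵁ-assoc-⊑ x y z)
  ( ⊕ᵁ-comm-⊑ z (x ⊕ᵁ y)
  ∘ ⊕ᵁ-mono {x = z} {z} {y ⊕ᵁ x} {x ⊕ᵁ y} (λ p → p) (⊕ᵁ-comm-⊑ y x)
  ∘ ⊕ᵁ-assoc-⊑ z y x
  ∘ ⊕ᵁ-mono {x = y ⊕ᵁ z} {z ⊕ᵁ y} {x} {x} (⊕ᵁ-comm-⊑ y z) (λ p → p)
  ∘ ⊕ᵁ-comm-⊑ x (y ⊕ᵁ z))

⊕ᵁ-identityʳ : (x : UnitInterval ℓ) → x ⊕ᵁ 𝟘ᵁ ≈ᵁ x
⊕ᵁ-identityʳ x = ⊑-antisym
  (λ {q} (_ , r , s , r◁x , lift s<0 , q<r+s) → downward x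
    (by (ℚ.+-mono-< q<r+s s<0)
      (solve 3 (λ q r s → r :+ s :+ con 0ℚ :- (q :+ s) := r :- q) refl q r s)) r◁x)
  (λ {q} q◁x →
    let r , q<r , r◁x = rounded x q◁x
        s , q-r<s , s<0 = dense {q - r} {0ℚ}
          (by q<r (solve 2 (λ q r → r :- q := con 0ℚ :- (q :- r)) refl q r))
    in ≤1 x q◁x , r , s , r◁x , lift s<0 ,
       by q-r<s (solve 3 (λ q r s → s :- (q :- r) := r :+ s :- q) refl q r s))

⊕ᵁ-zeroʳ : (x : UnitInterval ℓ) → x ⊕ᵁ 𝟙ᵁ ≈ᵁ 𝟙ᵁ
⊕ᵁ-zeroʳ x = ⊑-antisym
  (λ (q<1 , _) → <1⇒◁𝟙 q<1)
  (λ {q} q◁1 →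
    let s , q<s , s<1 = dense (≤1 𝟙ᵁ q◁1)
        r , q-s<r , r<0 = dense {q - s} {0ℚ}
          (by q<s (solve 2 (λ q s → s :- q := con 0ℚ :- (q :- s)) refl q s))
    in ≤1 𝟙ᵁ q◁1 , r , s , 0≤ x r<0 , <1⇒◁𝟙 s<1 ,
       by q-s<r (solve 3 (λ q r s → r :- (q :- s) := r :+ s :- q) refl q r s))

infixr 7 _•_
_•_ : ℕ → ℚ → ℚ
ℕ.zero  • δ = 0ℚ
ℕ.suc n • δ = δ + n • δ

•-ᵘ : ∀ n δ → ℚ.toℚᵘ (n • δ) ℚᵘ.≃ ℚᵘ.mkℚᵘ (ℤ.+ n) 0 ℚᵘ.* ℚ.toℚᵘ δ
•-ᵘ ℕ.zero δ = ℚᵘ.≃-sym (ℚᵘ.*-zeroˡ (ℚ.toℚᵘ δ))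
•-ᵘ (ℕ.suc n) δ = begin
  ℚ.toℚᵘ (δ + n • δ)                       ≈⟨ ℚ.toℚᵘ-homo-+ δ (n • δ) ⟩
  d ℚᵘ.+ ℚ.toℚᵘ (n • δ)                    ≈⟨ ℚᵘ.+-cong (ℚᵘ.≃-sym (ℚᵘ.*-identityˡ d)) (•-ᵘ n δ) ⟩
  ℚᵘ.1ℚᵘ ℚᵘ.* d ℚᵘ.+ n′ ℚᵘ.* d             ≈⟨ ℚᵘ.≃-sym (ℚᵘ.*-distribʳ-+ d ℚᵘ.1ℚᵘ n′) ⟩
  (ℚᵘ.1ℚᵘ ℚᵘ.+ n′) ℚᵘ.* d                  ≈⟨ ℚᵘ.*-congʳ {d} {ℚᵘ.1ℚᵘ ℚᵘ.+ n′} {ℚᵘ.mkℚᵘ (ℤ.+ ℕ.suc n) 0} (ℚᵘ.*≡* eq) ⟩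
  ℚᵘ.mkℚᵘ (ℤ.+ ℕ.suc n) 0 ℚᵘ.* d           ∎
  where
  open ℚᵘ.≃-Reasoning
  d = ℚ.toℚᵘ δ
  n′ = ℚᵘ.mkℚᵘ (ℤ.+ n) 0
  eq : (ℤ.+ 1 ℤ.* ℤ.+ 1 ℤ.+ ℤ.+ n ℤ.* ℤ.+ 1) ℤ.* ℤ.+ 1 ≡ ℤ.+ ℕ.suc n ℤ.* ℤ.+ 1
  eq = ≡.cong (λ k → (ℤ.+ 1 ℤ.+ k) ℤ.* ℤ.+ 1) (ℤ.*-identityʳ (ℤ.+ n))

archimedean : ∀ {δ} → 0ℚ < δ → ∃[ n ] 1ℚ < n • δ
archimedean {δ@(ℚ.mkℚ (ℤ.+ ℕ.suc m) d _)} 0<δ = 2+d , ℚ.toℚᵘ-cancel-<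
  (ℚᵘ.<-respʳ-≃ (ℚᵘ.≃-sym (•-ᵘ 2+d δ)) (ℚᵘ.*<* (ℤ.+<+ (ℕ.s≤s d<2+d*m))))
  where
  2+d = ℕ.suc (ℕ.suc d)
  d<2+d*m : ℕ.suc (d ℕ.+ 0 ℕ.+ 0) ℕ.≤ (m ℕ.+ ℕ.suc d ℕ.* ℕ.suc m) ℕ.* 1
  d<2+d*m = ≡.subst₂ ℕ._≤_
    (≡.cong ℕ.suc (≡.sym (≡.trans (ℕ.+-identityʳ (d ℕ.+ 0)) (ℕ.+-identityʳ d))))
    (≡.sym (ℕ.*-identityʳ _))
    (ℕ.≤-trans (ℕ.m≤m*n (ℕ.suc d) (ℕ.suc m)) (ℕ.m≤n+m _ m))
archimedean {ℚ.mkℚ (ℤ.+ ℕ.zero) d _} (ℚ.*<* (ℤ.+<+ ()))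
archimedean {ℚ.mkℚ ℤ.-[1+ _ ] d _} (ℚ.*<* ())

module Classical (em : ∀ {ℓ} → ExcludedMiddle ℓ) where

  stable : {P : Set ℓ} → ¬ ¬ P → P
  stable = decidable-stable em

  ⋪⇒≥ : (x : UnitInterval ℓ) → ∀ {q r} → ¬ q ◁ x → r ◁ x → r < q
  ⋪⇒≥ x {q} {r} q⋪x r◁x with ℚ.<-cmp r q
  ... | tri< r<q _ _    = r<q
  ... | tri≈ _ refl _   = ⊥-elim (q⋪x r◁x)
  ... | tri> _ _ q<r    = ⊥-elim (q⋪x (downward x q<r r◁x))

  abstract
    -- s < x ≤ s + ε
    locate : (x : UnitInterval ℓ) → ∀ {ε} → 0ℚ < ε → ∃[ s ] s ◁ x × ¬ s + ε ◁ x
    locate x {ε} 0<ε =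
      let n , 1<n•ε = archimedean 0<ε
          s , 1-n•ε<s , s<0 = dense {1ℚ - n • ε} {0ℚ}
            (by 1<n•ε (solve 1 (λ e → e :- con 1ℚ := con 0ℚ :- (con 1ℚ :- e)) refl (n • ε)))
      in go n s (0≤ x s<0) λ s+n•ε◁x → ℚ.<-asym (≤1 x s+n•ε◁x)
           (by 1-n•ε<s (solve 2 (λ e s → s :- (con 1ℚ :- e) := s :+ e :- con 1ℚ)
             refl (n • ε) s))
      where
      go : ∀ n s → s ◁ x → ¬ s + n • ε ◁ x → ∃[ s ] s ◁ x × ¬ s + ε ◁ x
      go ℕ.zero s s◁x s+0⋪x =
        ⊥-elim (s+0⋪x (≡.subst (_◁ x) (≡.sym (ℚ.+-identityʳ s)) s◁x))
      go (ℕ.suc n) s s◁x s+⋪x with em {P = s + ε ◁ x}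
      ... | no  s+ε⋪x = s , s◁x , s+ε⋪x
      ... | yes s+ε◁x = go n (s + ε) s+ε◁x
            (s+⋪x ∘ ≡.subst (_◁ x) (ℚ.+-assoc s ε (n • ε)))

  total : (x y : UnitInterval ℓ) → x ⊑ y ⊎ y ⊑ x
  total x y with em {P = ∃[ q ] q ◁ x × ¬ q ◁ y}
  ... | yes (q , q◁x , q⋪y) = inj₂ λ r◁y → downward x (⋪⇒≥ y q⋪y r◁y) q◁x
  ... | no  x⊑y             = inj₁ λ q◁x → stable λ q⋪y → x⊑y (_ , q◁x , q⋪y)

  ∼ᵁ-involutive : (x : UnitInterval ℓ) → ∼ᵁ ∼ᵁ x ≈ᵁ x
  ∼ᵁ-involutive x = ⊑-antisym
    (λ {q} (r , q<r , 1-r⋪∼x) → stable λ q⋪x → 1-r⋪∼x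
      ( 1ℚ - q
      , by q<r (solve 2 (λ q r → r :- q := con 1ℚ :- q :- (con 1ℚ :- r)) refl q r)
      , ≡.subst (λ p → ¬ p ◁ x)
          (solve 1 (λ q → q := con 1ℚ :- (con 1ℚ :- q)) refl q) q⋪x))
    (λ {q} q◁x → let r , q<r , r◁x = rounded x q◁x in r , q<r , λ (s , 1-r<s , 1-s⋪x) →
      1-s⋪x (downward x
        (by 1-r<s (solve 2 (λ r s → s :- (con 1ℚ :- r) := r :- (con 1ℚ :- s)) refl r s))
        r◁x))

  ⊑⇒≤ : {x y : UnitInterval ℓ} → x ⊑ y → ∼ᵁ x ⊕ᵁ y ≈ᵁ 𝟙ᵁ
  ⊑⇒≤ {x = x} {y} x⊑y = ⊑-antisym
    (λ (q<1 , _) → <1⇒◁𝟙 q<1)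
    (λ {q} q◁1 →
      let q<1 = ≤1 𝟙ᵁ q◁1
          m , q<m , m<1 = dense q<1
          s , s◁x , s+ε⋪x = locate x {1ℚ - m}
            (by m<1 (solve 1 (λ m → con 1ℚ :- m := con 1ℚ :- m :- con 0ℚ) refl m))
          r , q-s<r , r<m-s = dense {q - s} {m - s} (ℚ.+-monoˡ-< (ℚ.- s) q<m)
      in q<1 , r , s ,
         (m - s , r<m-s , ≡.subst (λ p → ¬ p ◁ x)
           (solve 2 (λ m s → s :+ (con 1ℚ :- m) := con 1ℚ :- (m :- s)) refl m s) s+ε⋪x) ,
         x⊑y s◁x ,
         by q-s<r (solve 3 (λ q r s → r :- (q :- s) := r :+ s :- q) refl q r s))

  -- (x - y) + y = x for y ≤ x
  ∨ᵁ-⊑ : {x y : UnitInterval ℓ} → y ⊑ x → ∼ᵁ (∼ᵁ x ⊕ᵁ y) ⊕ᵁ y ⊑ x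
  ∨ᵁ-⊑ {x = x} {y} y⊑x {q} (q<1 , r , s , (r′ , r<r′ , 1-r′⋪) , s◁y , q<r+s)
    with 0ℚ ℚ.<? r′
  ... | no  r′≤0 = y⊑x (downward y
        (by (ℚ.+-mono-<-≤ (ℚ.+-mono-< q<r+s r<r′) (ℚ.≮⇒≥ r′≤0))
          (solve 4 (λ q r s r′ → r :+ s :+ r′ :+ con 0ℚ :- (q :+ r :+ r′) := s :- q)
            refl q r s r′)) s◁y)
  ... | yes 0<r′ = stable λ q⋪x →
        let u , 1-r′-s<u , u<1-q = dense {1ℚ - r′ - s} {1ℚ - q}
              (by (ℚ.+-mono-< q<r+s r<r′)
                (solve 4 (λ q r s r′ → r :+ s :+ r′ :- (q :+ r)
                           := con 1ℚ :- q :- (con 1ℚ :- r′ :- s)) refl q r s r′))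
        in 1-r′⋪
             ( by 0<r′ (solve 1 (λ r → r :- con 0ℚ := con 1ℚ :- (con 1ℚ :- r)) refl r′)
             , u , s
             , (1ℚ - q , u<1-q , ≡.subst (λ p → ¬ p ◁ x)
                  (solve 1 (λ q → q := con 1ℚ :- (con 1ℚ :- q)) refl q) q⋪x)
             , s◁y
             , by 1-r′-s<u (solve 3 (λ r s u → u :- (con 1ℚ :- r :- s)
                                        := u :+ s :- (con 1ℚ :- r)) refl r′ s u))

  ∨ᵁ-⊒ : {x y : UnitInterval ℓ} → y ⊑ x → x ⊑ ∼ᵁ (∼ᵁ x ⊕ᵁ y) ⊕ᵁ y
  ∨ᵁ-⊒ {x = x} {y} y⊑x {q} q◁x =
    let q₁ , q<q₁ , q₁◁x = rounded x q◁x
        q₂ , q₁<q₂ , q₂◁x = rounded x q₁◁x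
        s , s◁y , s+ε⋪y = locate y {q₂ - q₁}
          (by q₁<q₂ (solve 2 (λ p q → q :- p := q :- p :- con 0ℚ) refl q₁ q₂))
        r , q-s<r , r<q₁-s = dense {q - s} {q₁ - s} (ℚ.+-monoˡ-< (ℚ.- s) q<q₁)
    in ≤1 x q◁x , r , s ,
       (q₁ - s , r<q₁-s , λ (_ , u , v , (w , u<w , 1-w⋪x) , v◁y , 1-<u+v) →
         ℚ.<-irrefl refl
           (by {s = 0ℚ} (ℚ.+-mono-< (ℚ.+-mono-< 1-<u+v (⋪⇒≥ y s+ε⋪y v◁y))
                          (ℚ.+-mono-< u<w (⋪⇒≥ x 1-w⋪x q₂◁x)))
             (solve 6 (λ q₁ q₂ s u v w →
                  u :+ v :+ (s :+ (q₂ :- q₁)) :+ (w :+ (con 1ℚ :- w))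
                    :- (con 1ℚ :- (q₁ :- s) :+ v :+ (u :+ q₂))
                  := con 0ℚ :- con 0ℚ) refl q₁ q₂ s u v w))) ,
       s◁y ,
       by q-s<r (solve 3 (λ q r s → r :- (q :- s) := r :+ s :- q) refl q r s)

  ∨ᵁ-≥ : {x y : UnitInterval ℓ} → x ⊑ y → ∼ᵁ (∼ᵁ x ⊕ᵁ y) ⊕ᵁ y ≈ᵁ y
  ∨ᵁ-≥ {x = x} {y} x⊑y = ⊑-antisym
    ( ≈⇒⊑ (⊕ᵁ-identityʳ y)
    ∘ ⊕ᵁ-comm-⊑ 𝟘ᵁ y
    ∘ ⊕ᵁ-mono {x = ∼ᵁ (∼ᵁ x ⊕ᵁ y)} {𝟘ᵁ} {y} {y}
        ( ≈⇒⊑ (∼ᵁ-involutive 𝟘ᵁ)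
        ∘ ∼ᵁ-anti {x = 𝟙ᵁ} {∼ᵁ x ⊕ᵁ y} (≈⇒⊒ (⊑⇒≤ {x = x} {y} x⊑y)))
        (λ p → p))
    ( ⊕ᵁ-mono {x = 𝟘ᵁ} {∼ᵁ (∼ᵁ x ⊕ᵁ y)} {y} {y}
        (λ (lift q<0) → 0≤ (∼ᵁ (∼ᵁ x ⊕ᵁ y)) q<0) (λ p → p)
    ∘ ⊕ᵁ-comm-⊑ y 𝟘ᵁ
    ∘ ≈⇒⊒ (⊕ᵁ-identityʳ y))

  ∨ᵁ-comm : (x y : UnitInterval ℓ) → ∼ᵁ (∼ᵁ x ⊕ᵁ y) ⊕ᵁ y ≈ᵁ ∼ᵁ (∼ᵁ y ⊕ᵁ x) ⊕ᵁ x
  ∨ᵁ-comm x y with total x y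
  ... | inj₁ x⊑y = IsEquivalence.trans ≈ᵁ-isEquivalence (∨ᵁ-≥ {x = x} {y} x⊑y)
        (⊑-antisym (∨ᵁ-⊒ {x = y} {x} x⊑y) (∨ᵁ-⊑ {x = y} {x} x⊑y))
  ... | inj₂ y⊑x = IsEquivalence.trans ≈ᵁ-isEquivalence
        (⊑-antisym (∨ᵁ-⊑ {x = x} {y} y⊑x) (∨ᵁ-⊒ {x = x} {y} y⊑x))
        (IsEquivalence.sym ≈ᵁ-isEquivalence (∨ᵁ-≥ {x = y} {x} y⊑x))

  ≤⇒⊑ : {x y : UnitInterval ℓ} → ∼ᵁ x ⊕ᵁ y ≈ᵁ 𝟙ᵁ → x ⊑ y
  ≤⇒⊑ {x = x} {y} x≤y with total x y
  ... | inj₁ x⊑y = x⊑y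
  ... | inj₂ y⊑x =
      ≈⇒⊑ (⊕ᵁ-identityʳ y)
    ∘ ⊕ᵁ-comm-⊑ 𝟘ᵁ y
    ∘ ⊕ᵁ-mono {x = ∼ᵁ (∼ᵁ x ⊕ᵁ y)} {𝟘ᵁ} {y} {y}
        (≈⇒⊑ (∼ᵁ-involutive 𝟘ᵁ) ∘ ∼ᵁ-anti {x = 𝟙ᵁ} {∼ᵁ x ⊕ᵁ y} (≈⇒⊒ x≤y)) (λ p → p)
    ∘ ∨ᵁ-⊒ {x = x} {y} y⊑x

  split : ∀ {q r s} → q < r + s → ∃[ a ] ∃[ b ] a < r × b < s × q < a + b
  split {q} {r} {s} q<r+s =
    let a , q-s<a , a<r = dense {q - s} {r}
          (by q<r+s (solve 3 (λ q r s → r :+ s :- q := r :- (q :- s)) refl q r s))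
        b , b<s , q<a+b = split₂ a q-s<a
    in a , b , a<r , b<s , q<a+b
    where
    split₂ : ∀ a → q - s < a → ∃[ b ] b < s × q < a + b
    split₂ a q-s<a =
      let b , q-a<b , b<s = dense {q - a} {s}
            (by q-s<a (solve 3 (λ q s a → a :- (q :- s) := s :- (q :- a)) refl q s a))
      in b , b<s , by q-a<b (solve 3 (λ q a b → b :- (q :- a) := a :+ b :- q) refl q a b)

  ⟦⟧-⊕ : ∀ r s t → (proj₁ r + proj₁ s) ℚ.⊓ 1ℚ ≡ proj₁ t → ⟦_⟧ {ℓ} r ⊕ᵁ ⟦ s ⟧ ≈ᵁ ⟦ t ⟧
  ⟦⟧-⊕ (r , _) (s , _) (t , _) eq = ⊑-antisym
    (λ (q<1 , a , b , lift a<r , lift b<s , q<a+b) → lift (≡.subst (_ <_) eq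
      (<-⊓ {q = r + s} {1ℚ} (ℚ.<-trans q<a+b (ℚ.+-mono-< a<r b<s)) q<1)))
    (λ {q} (lift q<t) →
      let q<min = ≡.subst (q <_) (≡.sym eq) q<t
          a , b , a<r , b<s , q<a+b = split (ℚ.<-≤-trans q<min (ℚ.p⊓q≤p (r + s) 1ℚ))
      in ℚ.<-≤-trans q<min (ℚ.p⊓q≤q (r + s) 1ℚ) , a , b , lift a<r , lift b<s , q<a+b)

  ⟦⟧-∼ : ∀ r s → 1ℚ - proj₁ r ≡ proj₁ s → ∼ᵁ ⟦_⟧ {ℓ} r ≈ᵁ ⟦ s ⟧
  ⟦⟧-∼ (r , _) (s , _) eq = ⊑-antisym
    (λ {q} (u , q<u , 1-u≮r) → lift (≡.subst (q <_) eq
      (by (ℚ.+-mono-<-≤ q<u (ℚ.≮⇒≥ (1-u≮r ∘ lift)))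
        (solve 3 (λ q r u → u :+ (con 1ℚ :- u) :- (q :+ r) := con 1ℚ :- r :- q) refl q r u))))
    (λ {q} (lift q<s) → 1ℚ - r , ≡.subst (q <_) (≡.sym eq) q<s , λ (lift r<r) → ℚ.<-irrefl refl
      (≡.subst (_< r) (solve 1 (λ r → con 1ℚ :- (con 1ℚ :- r) := r) refl r) r<r))

  unitInterval : ∀ ℓ → PavelkaAlgebra (suc ℓ) ℓ
  unitInterval ℓ = record
    { rawPavelkaAlgebra = rawUnitInterval ℓ
    ; isPavelkaAlgebra  = record
      { isMVAlgebra = record
        { ⊕-isCommutativeMonoid = record
          { isMonoid = record
            { isSemigroup = record
              { isMagma = record
                { isEquivalence = ≈ᵁ-isEquivalence
                ; ∙-cong        = λ {x} {y} {u} {v} x≈y u≈v → ⊑-antisym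
                    (⊕ᵁ-mono {x = x} {y} {u} {v} (≈⇒⊑ x≈y) (≈⇒⊑ u≈v))
                    (⊕ᵁ-mono {x = y} {x} {v} {u} (≈⇒⊒ x≈y) (≈⇒⊒ u≈v))
                }
              ; assoc   = ⊕ᵁ-assoc
              }
            ; identity  =
                (λ x → ⊑-antisym
                  (≈⇒⊑ (⊕ᵁ-identityʳ x) ∘ ⊕ᵁ-comm-⊑ 𝟘ᵁ x)
                  (⊕ᵁ-comm-⊑ x 𝟘ᵁ ∘ ≈⇒⊒ (⊕ᵁ-identityʳ x))) ,
                ⊕ᵁ-identityʳ
            }
          ; comm        = λ x y → ⊑-antisym (⊕ᵁ-comm-⊑ x y) (⊕ᵁ-comm-⊑ y x)
          }
        ; ∼-cong       = λ {x} {y} x≈y → ⊑-antisym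
            (∼ᵁ-anti {x = y} {x} (≈⇒⊒ x≈y)) (∼ᵁ-anti {x = x} {y} (≈⇒⊑ x≈y))
        ; ∼-involutive = ∼ᵁ-involutive
        ; ⊕-zeroʳ      = ⊕ᵁ-zeroʳ
        ; ∨-comm       = ∨ᵁ-comm
        }
      ; const-⊕     = ⟦⟧-⊕
      ; const-∼     = ⟦⟧-∼
      }
    }

  infix 9 [0,1]^_
  [0,1]^_ : Set ℓ → PavelkaAlgebra (suc ℓ) ℓ
  [0,1]^_ {ℓ} I = record
    { rawPavelkaAlgebra = record
      { Carrier = I → UnitInterval ℓ
      ; _≈_     = λ x y → ∀ i → x i ≈ᵁ y i
      ; _⊕_     = λ x y i → x i ⊕ᵁ y i
      ; ∼_      = λ x i → ∼ᵁ x i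
      ; const   = λ r i → ⟦ r ⟧
      }
    ; isPavelkaAlgebra  = record
      { isMVAlgebra = record
        { ⊕-isCommutativeMonoid = record
          { isMonoid = record
            { isSemigroup = record
              { isMagma = record
                { isEquivalence = record
                  { refl  = λ i → ≈-refl
                  ; sym   = λ p i → ≈-sym (p i)
                  ; trans = λ p q i → ≈-trans (p i) (q i)
                  }
                ; ∙-cong        = λ p q i → ⊕-cong (p i) (q i)
                }
              ; assoc   = λ x y z i → ⊕-assoc (x i) (y i) (z i)
              }
            ; identity  = (λ x i → ⊕-identityˡ (x i)) , (λ x i → ⊕-identityʳ (x i))
            }
          ; comm        = λ x y i → ⊕-comm (x i) (y i)
          }
        ; ∼-cong       = λ p i → ∼-cong (p i)
        ; ∼-involutive = λ x i → ∼-involutive (x i)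
        ; ⊕-zeroʳ      = λ x i → ⊕-zeroʳ (x i)
        ; ∨-comm       = λ x y i → ∨-comm (x i) (y i)
        }
      ; const-⊕     = λ r s t eq i → const-⊕ r s t eq
      ; const-∼     = λ r s eq i → const-∼ r s eq
      }
    }
    where
    open PavelkaAlgebra (unitInterval ℓ) using (mvAlgebra; isMVAlgebra; const-⊕; const-∼)
    open IsMVAlgebra isMVAlgebra
    open MVProperties mvAlgebra

abstract
  clamp : ∀ q → 0ℚ ℚ.≤ q → ℚ₀₁
  clamp q 0≤q = q ℚ.⊓ 1ℚ , ℚ.⊓-glb 0≤q (ℚ.<⇒≤ 0<1) , ℚ.p⊓q≤q q 1ℚ

  proj₁-clamp : ∀ q 0≤q → q ℚ.⊓ 1ℚ ≡ proj₁ (clamp q 0≤q)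
  proj₁-clamp q 0≤q = refl

  1-_ : ℚ₀₁ → ℚ₀₁
  1- (r , 0≤r , r≤1) = 1ℚ - r ,
    by≤ r≤1 (solve 1 (λ r → con 1ℚ :- r := con 1ℚ :- r :- con 0ℚ) refl r) ,
    by≤ 0≤r (solve 1 (λ r → r :- con 0ℚ := con 1ℚ :- (con 1ℚ :- r)) refl r)

  proj₁-1- : ∀ r → 1ℚ - proj₁ r ≡ proj₁ (1- r)
  proj₁-1- r = refl

  clamp-+ : ∀ {p} → 0ℚ ℚ.≤ p → ∀ q → (p + q ℚ.⊓ 1ℚ) ℚ.⊓ 1ℚ ≡ (p + q) ℚ.⊓ 1ℚ
  clamp-+ {p} 0≤p q with ℚ.≤-total q 1ℚ
  ... | inj₁ q≤1 = ≡.cong (λ q → (p + q) ℚ.⊓ 1ℚ) (ℚ.p≤q⇒p⊓q≡p q≤1)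
  ... | inj₂ 1≤q = ≡.trans
    (≡.cong (λ q → (p + q) ℚ.⊓ 1ℚ) (ℚ.p≥q⇒p⊓q≡q 1≤q))
    (≡.trans (ℚ.p≥q⇒p⊓q≡q (ℚ.+-mono-≤ 0≤p (ℚ.≤-refl {1ℚ})))
      (≡.sym (ℚ.p≥q⇒p⊓q≡q (ℚ.+-mono-≤ 0≤p 1≤q))))

  difference : ∀ (s r : ℚ₀₁) → proj₁ s < proj₁ r →
    ∃[ d ] proj₁ d ≡ proj₁ r - proj₁ s × 0ℚ < proj₁ d × (proj₁ (1- r) + proj₁ s) ℚ.⊓ 1ℚ ≡ proj₁ (1- d)
  difference (s , 0≤s , s≤1) (r , 0≤r , r≤1) s<r =
    (r - s , ℚ.<⇒≤ 0<r-s , by≤ (ℚ.+-mono-≤ r≤1 0≤s)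
      (solve 2 (λ r s → con 1ℚ :+ s :- (r :+ con 0ℚ) := con 1ℚ :- (r :- s)) refl r s)) ,
    refl , 0<r-s ,
    ≡.trans (ℚ.p≤q⇒p⊓q≡p (by≤ (ℚ.<⇒≤ s<r)
        (solve 2 (λ r s → r :- s := con 1ℚ :- (con 1ℚ :- r :+ s)) refl r s)))
      (solve 2 (λ r s → con 1ℚ :- r :+ s := con 1ℚ :- (r :- s)) refl r s)
    where
    0<r-s : 0ℚ < r - s
    0<r-s = by s<r (solve 2 (λ r s → r :- s := r :- s :- con 0ℚ) refl r s)

module FilterProperties (A : PavelkaAlgebra c ℓ) {F : Pred (PavelkaAlgebra.Carrier A) (c ⊔ ℓ)}
    (isFilter : IsFilter A F) where
  open PavelkaAlgebra A
  open IsMVAlgebra isMVAlgebra using (∼-cong; ∼-involutive)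
  open MVProperties mvAlgebra
  open IsFilter isFilter

  infix 4 _≼_
  _≼_ : Rel Carrier (c ⊔ ℓ)
  x ≼ y = (x ⇒ y) ∈ F

  ∈-resp-≈ : ∀ {x y} → x ≈ y → x ∈ F → y ∈ F
  ∈-resp-≈ = upward ∘ ≤-reflexive

  𝟙∈ : 𝟙 ∈ F
  𝟙∈ = upward (x≤𝟙 (proj₁ nonempty)) (proj₂ nonempty)

  ≤⇒≼ : ∀ {x y} → x ≤ y → x ≼ y
  ≤⇒≼ x≤y = ∈-resp-≈ (≈-sym x≤y) 𝟙∈

  ≼-reflexive : ∀ {x y} → x ≈ y → x ≼ y
  ≼-reflexive = ≤⇒≼ ∘ ≤-reflexive

  ≼-trans : ∀ {x y z} → x ≼ y → y ≼ z → x ≼ z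
  ≼-trans x≼y y≼z = upward (⇒-trans _ _ _) (·-closed y≼z x≼y)

  𝟙≼⇒∈ : ∀ {x} → 𝟙 ≼ x → x ∈ F
  𝟙≼⇒∈ = ∈-resp-≈ (𝟙⇒x≈x _)

  ∈⇒𝟙≼ : ∀ {x} → x ∈ F → 𝟙 ≼ x
  ∈⇒𝟙≼ = ∈-resp-≈ (≈-sym (𝟙⇒x≈x _))

  ∼-anti-≼ : ∀ {x y} → x ≼ y → ∼ y ≼ ∼ x
  ∼-anti-≼ = ∈-resp-≈ (≈-sym (contraposition _ _))

  ⊕-monoˡ-≼ : ∀ {x y} z → x ≼ y → x ⊕ z ≼ y ⊕ z
  ⊕-monoˡ-≼ z = upward (⇒-⊕ _ _ z)

  ⊕-mono-≼ : ∀ {x y u v} → x ≼ y → u ≼ v → x ⊕ u ≼ y ⊕ v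
  ⊕-mono-≼ {x} {y} {u} {v} x≼y u≼v = ≼-trans (⊕-monoˡ-≼ u x≼y)
    (≼-trans (≼-reflexive (⊕-comm y u))
    (≼-trans (⊕-monoˡ-≼ y u≼v) (≼-reflexive (⊕-comm v y))))

  ·-mono-≼ : ∀ {x y u v} → x ≼ y → u ≼ v → x · u ≼ y · v
  ·-mono-≼ x≼y u≼v = ∼-anti-≼ (⊕-mono-≼ (∼-anti-≼ x≼y) (∼-anti-≼ u≼v))

-- x / F is the supremum of all rationals r with r → x in F.  That this is the
-- unique embedding of A / F is value-isMonomorphism and value-unique below.
module _ (A : PavelkaAlgebra c ℓ) (F : SpecM A) where
  open PavelkaAlgebra A
  open MVProperties mvAlgebra
  open SpecM F
  open FilterProperties A isFilter

  value : Carrier → UnitInterval (suc (c ⊔ ℓ))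
  value x .cut q =
    Lift (suc (c ⊔ ℓ)) (∃[ r ] q < proj₁ r × (const r ⇒ x) ∈ filter)
  value x .0≤ q<0 = lift (0₀₁ , q<0 , ≤⇒≼ (𝟘≤x x))
  value x .≤1 (lift ((r , _ , r≤1) , q<r , _)) = ℚ.<-≤-trans q<r r≤1
  value x .downward p<q (lift (r , q<r , r≼x)) = lift (r , ℚ.<-trans p<q q<r , r≼x)
  value x .rounded (lift (r , q<r , r≼x)) =
    let s , q<s , s<r = dense q<r in s , q<s , lift (r , s<r , r≼x)

module Hölder (em : ∀ {ℓ} → ExcludedMiddle ℓ) (A : PavelkaAlgebra c ℓ) (F : SpecM A) where
  open Classical em
  open PavelkaAlgebra A
  open IsMVAlgebra isMVAlgebra using (∼-cong; ∼-involutive)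
  open MVProperties mvAlgebra
  open SpecM F
  open FilterProperties A isFilter

  nilpotent : ∀ {a} → a ∉ filter → ∃[ n ] a ^ n ≼ 𝟘
  nilpotent {a} a∉F = stable λ ¬nil → a∉F (maximal
    (record
      { isFilter = record
        { nonempty = 𝟙 , 0 , ≤⇒≼ (x≤𝟙 _)
        ; upward   = λ { x≤y (n , aⁿ≼x) → n , ≼-trans aⁿ≼x (≤⇒≼ x≤y) }
        ; ·-closed = λ { (m , aᵐ≼x) (n , aⁿ≼y) → m ℕ.+ n ,
            ≼-trans (≼-reflexive (≈-sym (^-+ a m n))) (·-mono-≼ aᵐ≼x aⁿ≼y) }
        }
      ; proper   = λ all → ¬nil (all 𝟘)
      })
    (λ x∈F → 0 , ∈⇒𝟙≼ x∈F)
    (1 , ≤⇒≼ (unresidual (x≤y⇒x a 𝟙))))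

  ≼-total : ∀ x y → x ≼ y ⊎ y ≼ x
  ≼-total x y with em {P = x ≼ y}
  ... | yes x≼y = inj₁ x≼y
  ... | no  x⋠y with n , uⁿ≼𝟘 ← nilpotent x⋠y =
    inj₂ (upward (^-prelinear n (prelinearity x y)) (≼-trans uⁿ≼𝟘 (≤⇒≼ (𝟘≤x _))))

  const-cong : ∀ {r s} → proj₁ r ≡ proj₁ s → const r ≈ const s
  const-cong {r , p , q} {.r , p′ , q′} refl
    rewrite ℚ.≤-irrelevant p p′ | ℚ.≤-irrelevant q q′ = ≈-refl

  const-positive : ∀ d → 0ℚ < proj₁ d → ¬ const d ≼ 𝟘
  const-positive d@(δ , 0≤δ , _) 0<δ d≼𝟘 = impossible (archimedean 0<δ)
    where
    0≤• : ∀ n → 0ℚ ℚ.≤ n • δ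
    0≤• ℕ.zero    = ℚ.≤-refl
    0≤• (ℕ.suc n) = ℚ.+-mono-≤ 0≤δ (0≤• n)

    multiple : ℕ → ℚ₀₁
    multiple n = clamp (n • δ) (0≤• n)

    multiple≼𝟘 : ∀ n → const (multiple n) ≼ 𝟘
    multiple≼𝟘 ℕ.zero    = ≼-reflexive (const-cong (≡.sym (proj₁-clamp 0ℚ (0≤• 0))))
    multiple≼𝟘 (ℕ.suc n) = ≼-trans
      (≼-reflexive (≈-sym (const-⊕ d (multiple n) (multiple (ℕ.suc n))
        (≡.trans (≡.cong (λ p → (δ + p) ℚ.⊓ 1ℚ) (≡.sym (proj₁-clamp (n • δ) (0≤• n))))
          (≡.trans (clamp-+ 0≤δ (n • δ)) (proj₁-clamp _ (0≤• (ℕ.suc n))))))))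
      (≼-trans (⊕-mono-≼ d≼𝟘 (multiple≼𝟘 n)) (≼-reflexive (⊕-identityˡ 𝟘)))

    impossible : ¬ (∃[ n ] 1ℚ < n • δ)
    impossible (n , 1<nδ) = proper λ x → 𝟙≼⇒∈ (≼-trans (≼-trans
      (≼-reflexive (const-∼ 0₀₁ (multiple n)
        (≡.trans (≡.sym (ℚ.p≥q⇒p⊓q≡q (ℚ.<⇒≤ 1<nδ))) (proj₁-clamp _ (0≤• n)))))
      (multiple≼𝟘 n)) (≤⇒≼ (𝟘≤x x)))

  const-difference : ∀ d r s → (proj₁ (1- r) + proj₁ s) ℚ.⊓ 1ℚ ≡ proj₁ (1- d) →
                     const d ≈ ∼ (const r ⇒ const s)
  const-difference d r s eq = ≈-trans (≈-sym (∼-involutive _)) (∼-cong (≈-trans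
    (const-∼ d (1- d) (proj₁-1- d))
    (≈-sym (≈-trans (⊕-congʳ (const-∼ r (1- r) (proj₁-1- r))) (const-⊕ (1- r) s (1- d) eq)))))

  const-cancel : ∀ {r s} → const r ≼ const s → proj₁ r ℚ.≤ proj₁ s
  const-cancel {r} {s} r≼s = ℚ.≮⇒≥ λ s<r →
    let d , _ , 0<d , 1-r+s≡1-d = difference s r s<r
    in const-positive d 0<d (≼-trans
      (≼-reflexive (const-difference d r s 1-r+s≡1-d))
      (≼-trans (∼-anti-≼ (∈⇒𝟙≼ r≼s)) (≼-reflexive ∼𝟙≈𝟘)))

  private
    v : Carrier → UnitInterval (suc (c ⊔ ℓ))
    v = value A F

    𝕌 = unitInterval (suc (c ⊔ ℓ))
    module U = MVProperties (PavelkaAlgebra.mvAlgebra 𝕌)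
    ∼ᵁ-cong = IsMVAlgebra.∼-cong (PavelkaAlgebra.isMVAlgebra 𝕌)

  v-mono : ∀ {x y} → x ≼ y → v x ⊑ v y
  v-mono x≼y (lift (r , q<r , r≼x)) = lift (r , q<r , ≼-trans r≼x x≼y)

  v-const : ∀ r → v (const r) ≈ᵁ ⟦ r ⟧
  v-const r = ⊑-antisym
    (λ (lift (s , q<s , s≼r)) → lift (ℚ.<-≤-trans q<s (const-cancel {s} {r} s≼r)))
    (λ (lift q<r) → lift (r , q<r , ≼-reflexive ≈-refl))

  ⋪⇒≽ : ∀ {x q} → ¬ q ◁ v x → ∀ r → q < proj₁ r → x ≼ const r
  ⋪⇒≽ {x} q⋪vx r q<r with ≼-total x (const r)
  ... | inj₁ x≼r = x≼r
  ... | inj₂ r≼x = ⊥-elim (q⋪vx (lift (r , q<r , r≼x)))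

  v-∼ : ∀ x → v (∼ x) ≈ᵁ ∼ᵁ v x
  v-∼ x = ⊑-antisym
    (λ (lift (r , q<r , r≼∼x)) → below r r≼∼x (dense q<r))
    (λ (t , q<t , 1-t⋪vx) → above q<t 1-t⋪vx)
    where
    below : ∀ {q} r → const r ≼ ∼ x → ∃[ t ] q < t × t < proj₁ r → q ◁ ∼ᵁ v x
    below r r≼∼x (t , q<t , t<r) = t , q<t , λ (lift (s , 1-t<s , s≼x)) →
      ℚ.<-irrefl refl (ℚ.<-≤-trans (ℚ.<-trans
        (≡.subst (_< 1ℚ - t) (proj₁-1- r) (ℚ.+-monoʳ-< 1ℚ (ℚ.neg-antimono-< t<r))) 1-t<s)
        (const-cancel {s} {1- r} (≼-trans s≼x
          (≼-trans (≼-reflexive (≈-sym (∼-involutive x)))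
          (≼-trans (∼-anti-≼ r≼∼x) (≼-reflexive (const-∼ r (1- r) (proj₁-1- r))))))))

    above : ∀ {q t} → q < t → ¬ 1ℚ - t ◁ v x → q ◁ v (∼ x)
    above {q} {t} q<t 1-t⋪vx with q ℚ.<? 0ℚ
    ... | yes q<0 = 0≤ (v (∼ x)) q<0
    ... | no  q≮0 = step (dense q<t)
      where
      t≤1 : t ℚ.≤ 1ℚ
      t≤1 = ℚ.≮⇒≥ λ 1<t → 1-t⋪vx (0≤ (v x)
        (by 1<t (solve 1 (λ t → t :- con 1ℚ := con 0ℚ :- (con 1ℚ :- t)) refl t)))

      step₂ : ∀ r → q < proj₁ r → proj₁ r < t → q ◁ v (∼ x)
      step₂ r q<r r<t = lift (r , q<r , ≼-trans
        (≼-reflexive (≈-trans (≈-sym (∼-involutive _)) (∼-cong (const-∼ r (1- r) (proj₁-1- r)))))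
        (∼-anti-≼ (⋪⇒≽ 1-t⋪vx (1- r) (≡.subst (1ℚ - t <_) (proj₁-1- r)
          (ℚ.+-monoʳ-< 1ℚ (ℚ.neg-antimono-< r<t))))))

      step : ∃[ r ] q < r × r < t → q ◁ v (∼ x)
      step (r , q<r , r<t) = step₂
        (r , ℚ.≤-trans (ℚ.≮⇒≥ q≮0) (ℚ.<⇒≤ q<r) , ℚ.≤-trans (ℚ.<⇒≤ r<t) t≤1) q<r r<t

  v-⊕ : ∀ x y → v (x ⊕ y) ≈ᵁ v x ⊕ᵁ v y
  v-⊕ x y = ⊑-antisym
    (λ (lift (r , q<r , r≼x⊕y)) → ℚ.<-≤-trans q<r (proj₂ (proj₂ r)) , below r q<r r≼x⊕y)
    (λ (q<1 , a , b , lift (r , a<r , r≼x) , lift (s , b<s , s≼y) , q<a+b) →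
      above r s q<1 (ℚ.<-trans q<a+b (ℚ.+-mono-< a<r b<s)) r≼x s≼y)
    where
    above : ∀ {q} r s → q < 1ℚ → q < proj₁ r + proj₁ s →
            const r ≼ x → const s ≼ y → q ◁ v (x ⊕ y)
    above {q} r s q<1 q<r+s r≼x s≼y = lift
      (t , ≡.subst (q <_) r⊕s≡t (<-⊓ {q = proj₁ r + proj₁ s} {1ℚ} q<r+s q<1) ,
       ≼-trans (≼-reflexive (≈-sym (const-⊕ r s t r⊕s≡t))) (⊕-mono-≼ r≼x s≼y))
      where
      0≤r+s = ℚ.+-mono-≤ (proj₁ (proj₂ r)) (proj₁ (proj₂ s))
      t = clamp (proj₁ r + proj₁ s) 0≤r+s
      r⊕s≡t = proj₁-clamp (proj₁ r + proj₁ s) 0≤r+s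

    below : ∀ {q} r → q < proj₁ r → const r ≼ x ⊕ y →
            ∃[ a ] ∃[ b ] a ◁ v x × b ◁ v y × q < a + b
    below {q} r q<r r≼x⊕y = let m , q<m , m<r = dense q<r in step₁ m q<m m<r
      where
      Goal = ∃[ a ] ∃[ b ] a ◁ v x × b ◁ v y × q < a + b

      finish : ∀ s → s ◁ v x → ∀ b → q - s < b → b ◁ v y → Goal
      finish s s◁vx b q-s<b b◁vy = s , b , s◁vx , b◁vy ,
        by q-s<b (solve 3 (λ q s b → b :- (q :- s) := s :+ b :- q) refl q s b)

      step₃ : ∀ s → s ◁ v x → ∀ u → x ≼ const u →
              proj₁ u < s + (proj₁ r - q) → proj₁ u < proj₁ r → Goal
      step₃ s s◁vx u x≼u u<top u<r =
        let d , d≡r-u , _ , eq = difference u r u<r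
            b , q-s<b , b<d = dense {q - s} {proj₁ d} (≡.subst (q - s <_) (≡.sym d≡r-u)
              (by u<top (solve 4 (λ q s u r → s :+ (r :- q) :- u := r :- u :- (q :- s))
                refl q s (proj₁ u) (proj₁ r))))
        in finish s s◁vx b q-s<b (lift (d , b<d , ≼-trans
             (≼-reflexive (const-difference d r u eq))
             (∈-resp-≈ (≈-trans (≈-sym (⊕-assoc _ _ _)) (⊕-congʳ (≈-sym (∼-involutive _))))
               (≼-trans r≼x⊕y (⊕-monoˡ-≼ y x≼u)))))

      step₂ : ∀ s ε → s ◁ v x → ¬ s + ε ◁ v x →
              ∀ u → s + ε < u → u < s + (proj₁ r - q) → Goal
      step₂ s ε s◁vx s+ε⋪vx u s+ε<u u<top with u ℚ.<? proj₁ r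
      ... | yes u<r = step₃ s s◁vx u₀ (⋪⇒≽ s+ε⋪vx u₀ s+ε<u) u<top u<r
        where
        u₀ : ℚ₀₁
        u₀ = u , ℚ.≮⇒≥ (λ u<0 → s+ε⋪vx (0≤ (v x) (ℚ.<-trans s+ε<u u<0))) ,
             ℚ.≤-trans (ℚ.<⇒≤ u<r) (proj₂ (proj₂ r))
      ... | no  u≮r =
        let b , q-s<b , b<0 = dense {q - s} {0ℚ} (by (ℚ.+-mono-<-≤ u<top (ℚ.≮⇒≥ u≮r))
              (solve 4 (λ q s u r → s :+ (r :- q) :+ u :- (u :+ r) := con 0ℚ :- (q :- s))
                refl q s u (proj₁ r)))
        in finish s s◁vx b q-s<b (0≤ (v y) b<0)

      step₁ : ∀ m → q < m → m < proj₁ r → Goal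
      step₁ m q<m m<r =
        let s , s◁vx , s+ε⋪vx = locate (v x) {m - q}
              (by q<m (solve 2 (λ q m → m :- q := m :- q :- con 0ℚ) refl q m))
            u , s+ε<u , u<top = dense {s + (m - q)} {s + (proj₁ r - q)}
              (ℚ.+-monoʳ-< s (ℚ.+-monoˡ-< (ℚ.- q) m<r))
        in step₂ s (m - q) s◁vx s+ε⋪vx u s+ε<u u<top

  v-𝟙 : ∀ {x} → x ∈ filter → v x ≈ᵁ 𝟙ᵁ
  v-𝟙 x∈F = ⊑-antisym (<1⇒◁𝟙 ∘ ≤1 (v _))
    (v-mono (∈⇒𝟙≼ x∈F) ∘ ≈⇒⊒ (U.≈-trans (v-∼ 𝟘) (∼ᵁ-cong (v-const 0₀₁))))

  v-· : ∀ {x y} → v x ≈ᵁ 𝟙ᵁ → v y ≈ᵁ 𝟙ᵁ → v (x · y) ≈ᵁ 𝟙ᵁ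
  v-· {x} {y} vx≈1 vy≈1 = begin
    v (∼ (∼ x ⊕ ∼ y))               ≈⟨ v-∼ _ ⟩
    ∼ᵁ v (∼ x ⊕ ∼ y)                ≈⟨ ∼ᵁ-cong (v-⊕ _ _) ⟩
    ∼ᵁ (v (∼ x) ⊕ᵁ v (∼ y))         ≈⟨ ∼ᵁ-cong (U.⊕-cong (v∼≈0 vx≈1) (v∼≈0 vy≈1)) ⟩
    ∼ᵁ (𝟘ᵁ ⊕ᵁ 𝟘ᵁ)                   ≈⟨ ∼ᵁ-cong (⊕ᵁ-identityʳ 𝟘ᵁ) ⟩
    𝟙ᵁ                              ∎
    where
    open SetoidReasoning U.setoid
    v∼≈0 : ∀ {x} → v x ≈ᵁ 𝟙ᵁ → v (∼ x) ≈ᵁ 𝟘ᵁ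
    v∼≈0 vx≈1 = U.≈-trans (v-∼ _) (U.≈-trans (∼ᵁ-cong vx≈1) U.∼𝟙≈𝟘)

  v-^ : ∀ {x} n → v x ≈ᵁ 𝟙ᵁ → v (x ^ n) ≈ᵁ 𝟙ᵁ
  v-^ ℕ.zero    vx≈1 = v-𝟙 𝟙∈
  v-^ (ℕ.suc n) vx≈1 = v-· vx≈1 (v-^ n vx≈1)

  v-reflects : ∀ {x y} → v x ⊑ v y → x ≼ y
  v-reflects {x} {y} vx⊑vy = stable (¬nilpotent ∘ nilpotent)
    where
    u≈1 : v (x ⇒ y) ≈ᵁ 𝟙ᵁ
    u≈1 = U.≈-trans (v-⊕ (∼ x) y)
      (U.≈-trans (U.⊕-congʳ (v-∼ x)) (⊑⇒≤ {x = v x} {v y} vx⊑vy))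

    ¬nilpotent : ¬ (∃[ n ] (x ⇒ y) ^ n ≼ 𝟘)
    ¬nilpotent (n , uⁿ≼𝟘) = ℚ.<-irrefl refl (lower (≈⇒⊑ (v-const 0₀₁) 0◁v𝟘))
      where
      0◁vuⁿ : 0ℚ ◁ v ((x ⇒ y) ^ n)
      0◁vuⁿ = ≈⇒⊒ (v-^ n u≈1) (<1⇒◁𝟙 0<1)

      0◁v𝟘 : 0ℚ ◁ v 𝟘
      0◁v𝟘 = v-mono {(x ⇒ y) ^ n} {𝟘} uⁿ≼𝟘 0◁vuⁿ

  value-isMonomorphism :
    IsPavelkaMonomorphism (A / F) (rawUnitInterval (suc (c ⊔ ℓ))) (value A F)
  value-isMonomorphism = record
    { isMVMonomorphism = record
      { cong      = λ (x≼y , y≼x) → ⊑-antisym (v-mono x≼y) (v-mono y≼x)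
      ; ⊕-homo    = v-⊕
      ; ∼-homo    = v-∼
      ; 𝟘-homo    = v-const 0₀₁
      ; injective = λ vx≈vy → v-reflects (≈⇒⊑ vx≈vy) , v-reflects (≈⇒⊒ vx≈vy)
      }
    ; const-homo       = v-const
    }

  value-unique : ∀ {h} → IsPavelkaMonomorphism (A / F) (rawUnitInterval (suc (c ⊔ ℓ))) h →
                 ∀ x → h x ≈ᵁ value A F x
  value-unique {h} mono x = ⊑-antisym
    (λ q◁hx → let r , q<r , r◁hx = rounded (h x) q◁hx in below q<r r◁hx)
    (λ (lift (r , q<r , r≼x)) → ≤⇒⊑ {x = ⟦ r ⟧} {h x}
      (U.≈-trans (U.≈-sym (h-⇒ r)) (U.≈-trans
        (H.cong (≤⇒≼ (x≤𝟙 _) , ∈⇒𝟙≼ r≼x)) h-𝟙)) (lift q<r))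
    where
    module H = IsPavelkaMonomorphism mono

    h-𝟙 : h 𝟙 ≈ᵁ 𝟙ᵁ
    h-𝟙 = U.≈-trans (H.∼-homo 𝟘) (∼ᵁ-cong H.𝟘-homo)

    h-⇒ : ∀ r → h (const r ⇒ x) ≈ᵁ ∼ᵁ ⟦ r ⟧ ⊕ᵁ h x
    h-⇒ r = U.≈-trans (H.⊕-homo _ _) (U.⊕-congʳ (U.≈-trans (H.∼-homo _) (∼ᵁ-cong (H.const-homo r))))

    below : ∀ {q r} → q < r → r ◁ h x → q ◁ v x
    below {q} {r} q<r r◁hx with r ℚ.<? 0ℚ
    ... | yes r<0 = 0≤ (v x) (ℚ.<-trans q<r r<0)
    ... | no  r≮0 = lift (r₀ , q<r , 𝟙≼⇒∈ (proj₂ (H.injective (U.≈-trans (h-⇒ r₀)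
          (U.≈-trans (⊑⇒≤ {x = ⟦ r₀ ⟧} {h x} (λ (lift s<r) → downward (h x) s<r r◁hx)) (U.≈-sym h-𝟙))))))
      where
      r₀ : ℚ₀₁
      r₀ = r , ℚ.≮⇒≥ r≮0 , ℚ.<⇒≤ (≤1 (h x) r◁hx)

natural : (A : PavelkaAlgebra c ℓ) → PavelkaAlgebra.Carrier A →
          SpecM A → UnitInterval (suc (c ⊔ ℓ))
natural A x F = value A F x

-- In symbols: f ⇆ g.
record IsStrongLeftAdjoint (A : PavelkaAlgebra c ℓ) (B : PavelkaAlgebra c′ ℓ′)
    (f : PavelkaAlgebra.Carrier A → PavelkaAlgebra.Carrier B)
    (g : PavelkaAlgebra.Carrier B → PavelkaAlgebra.Carrier A) : Set (c ⊔ ℓ ⊔ c′ ⊔ ℓ′) where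
  private
    module A = PavelkaAlgebra A
    module B = PavelkaAlgebra B
  field
    f-monotone : ∀ {x y} → x A.≤ y → f x B.≤ f y
    g-monotone : ∀ {x y} → x B.≤ y → g x A.≤ g y
    adjoint    : ∀ x y → x B.≤ f y ⇔ g x A.≤ y
    strong     : ∀ r x → (B.const r B.⇒ f x) B.≈ f (A.const r A.⇒ x)

f[_] : {I J : Set ℓ} → (I → J → UnitInterval ℓ) →
       (I → UnitInterval ℓ) → (J → UnitInterval ℓ)
f[ R ] x j = ⋀ λ i → R i j ⇒ᵁ x i

g[_] : {I J : Set ℓ} → (I → J → UnitInterval ℓ) →
       (J → UnitInterval ℓ) → (I → UnitInterval ℓ)
g[ R ] y i = ⋁ λ j → R i j ·ᵁ y j

ZornsLemma : ∀ c ℓ₁ ℓ₂ → Set (suc (c ⊔ ℓ₁ ⊔ ℓ₂))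
ZornsLemma c ℓ₁ ℓ₂ = (P : Poset c ℓ₁ ℓ₂) → let open Poset P in
  ((C : Pred Carrier (c ⊔ ℓ₁ ⊔ ℓ₂)) →
    (∀ {x y} → x ∈ C → y ∈ C → x ≤ y ⊎ y ≤ x) →
    ∃[ u ] (∀ {x} → x ∈ C → x ≤ u)) →
  ∃[ m ] (∀ {x} → m ≤ x → m ≈ x)

{-# OPTIONS --safe #-}
module Submission where

-- Fix a maximal filter G of B and let N = { b ∣ f b ∈ G }, an up-set of A
-- closed under ∧.  If r → f x ∉ G, then y = r → x lies outside N, and the
-- filter generated by x → r and all y → b with b ∈ N is proper: by
-- prelinearity, an equation ((y → b) · (x → r))ⁿ = 0 would force b ≤ y.  A
-- maximal filter F above it satisfies y/F ≤ R(F,G) and x/F ≤ r/F, so that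
-- R(F,G) → x/F ≤ (y → x)/F = (r ∨ x)/F = r.  Hence f_R(n x)(G) ≤ n(f x)(G); the
-- converse inequality holds by the choice of R.  The statement for g is dual:
-- ¬g¬ is a strong left adjoint of ¬f¬, and it yields the transposed relation.

open import Defs
open import Axiom.ExcludedMiddle using (ExcludedMiddle)
open import Data.Nat.Base as ℕ using (ℕ)
open import Data.Product using (Σ-syntax; ∃-syntax; _×_; _,_; proj₁; proj₂)
import Data.Rational as ℚ
open ℚ using (0ℚ)
import Data.Rational.Properties as ℚ
open import Data.Sum.Base using (_⊎_; inj₁; inj₂; [_,_])
open import Function.Base using (_∘_; id)
open import Function.Bundles using (mk⇔; module Equivalence)
open import Level using (Level; suc; _⊔_; Lift; lift; lower)
open import Relation.Binary using (Poset; IsEquivalence)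
open import Relation.Binary.PropositionalEquality using (refl)
open import Relation.Nullary using (¬_; yes; no)
open import Relation.Nullary.Decidable using (True; toWitness; fromWitness)
open import Relation.Unary using (Pred; _∈_; _∉_; _⊆_)

private variable
  c ℓ : Level

-- Lattice operations, products and powers in an MV-algebra.

module MVOrder (M : MVAlgebra c ℓ) where
  open MVAlgebra M
  open MVProperties M

  ∼-anti : ∀ {x y} → x ≤ y → ∼ y ≤ ∼ x
  ∼-anti {x} {y} x≤y = ≈-trans (contraposition x y) x≤y

  y≤x∨y : ∀ x y → y ≤ x ∨ y
  y≤x∨y x y = x≤y⇒x y (x ⇒ y)

  x≤x∨y : ∀ x y → x ≤ x ∨ y
  x≤x∨y x y = ≤-trans (y≤x∨y y x) (≤-reflexive (∨-comm y x))

  -- As `x ∨ y` is `(x ⇒ y) ⇒ y`, it is monotone in `x`, hence below `z ∨ y`, which is `z`.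
  ∨-lub : ∀ {x y z} → x ≤ z → y ≤ z → x ∨ y ≤ z
  ∨-lub {x} {y} {z} x≤z y≤z = ≤-trans (⇒-antiˡ y (⇒-antiˡ y x≤z))
    (≤-reflexive (≈-trans (∨-comm z y) (≤⇒∨≈ y≤z)))

  ∧-lowerˡ : ∀ x y → x ∧ y ≤ x
  ∧-lowerˡ x y = ≤-trans (∼-anti (x≤x∨y (∼ x) (∼ y))) (≤-reflexive (∼-involutive x))

  ∧-lowerʳ : ∀ x y → x ∧ y ≤ y
  ∧-lowerʳ x y = ≤-trans (∼-anti (y≤x∨y (∼ x) (∼ y))) (≤-reflexive (∼-involutive y))

  ∧-glb : ∀ {x y z} → z ≤ x → z ≤ y → z ≤ x ∧ y
  ∧-glb {z = z} z≤x z≤y = ≤-trans (≤-reflexive (≈-sym (∼-involutive z)))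
    (∼-anti (∨-lub (∼-anti z≤x) (∼-anti z≤y)))

  ·-mono : ∀ {x y u v} → x ≤ y → u ≤ v → x · u ≤ y · v
  ·-mono {y = y} {u} {v} x≤y u≤v = ≤-trans (·-monoˡ u x≤y)
    (≤-trans (≤-reflexive (·-comm y u))
    (≤-trans (·-monoˡ y u≤v) (≤-reflexive (·-comm v y))))

  x·y≤x : ∀ x y → x · y ≤ x
  x·y≤x x y = unresidual (x≤y⇒x x y)

  x·y≤y : ∀ x y → x · y ≤ y
  x·y≤y x y = ≤-trans (≤-reflexive (·-comm x y)) (x·y≤x y x)

  x·y≤x∧y : ∀ x y → x · y ≤ x ∧ y
  x·y≤x∧y x y = ∧-glb (x·y≤x x y) (x·y≤y x y)

  ^-mono : ∀ {x y} n → x ≤ y → x ^ n ≤ y ^ n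
  ^-mono ℕ.zero    x≤y = ≤-refl
  ^-mono (ℕ.suc n) x≤y = ·-mono x≤y (^-mono n x≤y)

-- Strong left adjoints and their duals under negation.

module StrongLeftAdjoint {A B : PavelkaAlgebra c ℓ}
    {f : PavelkaAlgebra.Carrier A → PavelkaAlgebra.Carrier B}
    {g : PavelkaAlgebra.Carrier B → PavelkaAlgebra.Carrier A}
    (f⇆g : IsStrongLeftAdjoint A B f g) where
  open IsStrongLeftAdjoint f⇆g
  private
    module A where
      open PavelkaAlgebra A public
      open MVProperties mvAlgebra public
      open MVOrder mvAlgebra public
      open IsMVAlgebra isMVAlgebra public using (∼-cong; ∼-involutive)
    module B where
      open PavelkaAlgebra B public
      open MVProperties mvAlgebra public
      open MVOrder mvAlgebra public
      open IsMVAlgebra isMVAlgebra public using (∼-cong; ∼-involutive)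

  transpose : ∀ {x y} → x B.≤ f y → g x A.≤ y
  transpose = Equivalence.to (adjoint _ _)

  untranspose : ∀ {x y} → g x A.≤ y → x B.≤ f y
  untranspose = Equivalence.from (adjoint _ _)

  unit : ∀ y → y B.≤ f (g y)
  unit y = untranspose A.≤-refl

  counit : ∀ x → g (f x) A.≤ x
  counit x = transpose B.≤-refl

  g-cong : ∀ {x y} → x B.≈ y → g x A.≈ g y
  g-cong x≈y = A.≤-antisym (g-monotone (B.≤-reflexive x≈y))
    (g-monotone (B.≤-reflexive (B.≈-sym x≈y)))

  f-𝟙 : B.𝟙 B.≤ f A.𝟙
  f-𝟙 = untranspose (A.x≤𝟙 _)

  -- In the order, `f` is the upper half of the adjunction, so it preserves meets.
  f-∧ : ∀ x y → f x B.∧ f y B.≤ f (x A.∧ y)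
  f-∧ x y = untranspose (A.∧-glb
    (transpose (B.∧-lowerˡ (f x) (f y))) (transpose (B.∧-lowerʳ (f x) (f y))))

  -- The law `strong` transposed along the adjunction, with residuation by `r` on both sides.
  g-const-· : ∀ r y → A.const r A.· g y A.≈ g (B.const r B.· y)
  g-const-· r y = A.≤-antisym
    (A.≤-trans (A.≤-reflexive (A.·-comm _ _)) (A.unresidual (transpose
      (B.≤-trans (B.residual (B.≤-trans (B.≤-reflexive (B.·-comm _ _)) (unit _)))
        (B.≤-reflexive (strong r _))))))
    (transpose (B.≤-trans (B.≤-reflexive (B.·-comm _ _)) (B.unresidual
      (B.≤-trans (untranspose (A.residual (A.≤-reflexive (A.·-comm _ _))))
        (B.≤-reflexive (B.≈-sym (strong r _)))))))

  -- Negation reverses the order, so the upper and lower adjoints exchange roles; it also turns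
  -- `r · z` into `r ⇒ ∼ z`, so `strong` becomes `g-const-·`.
  dual : IsStrongLeftAdjoint B A (λ y → A.∼ g (B.∼ y)) (λ x → B.∼ f (A.∼ x))
  dual = record
    { f-monotone = λ x≤y → A.∼-anti (g-monotone (B.∼-anti x≤y))
    ; g-monotone = λ x≤y → B.∼-anti (f-monotone (A.∼-anti x≤y))
    ; adjoint    = λ x y → mk⇔
        (λ x≤∼g∼y → B.≤-trans (B.∼-anti (untranspose (A.≤-trans
            (A.≤-reflexive (A.≈-sym (A.∼-involutive _))) (A.∼-anti x≤∼g∼y))))
          (B.≤-reflexive (B.∼-involutive y)))
        (λ ∼f∼x≤y → A.≤-trans (A.≤-reflexive (A.≈-sym (A.∼-involutive x)))
          (A.∼-anti (transpose (B.≤-trans (B.∼-anti ∼f∼x≤y)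
            (B.≤-reflexive (B.∼-involutive _))))))
    ; strong     = λ r y → A.≈-trans (A.≈-sym (A.∼-involutive _))
        (A.∼-cong (A.≈-trans (g-const-· r (B.∼ y))
          (g-cong (B.∼-cong (B.⊕-congˡ (B.∼-involutive y))))))
    }

-- Extension of proper filters to maximal ones by Zorn's lemma.

module _ (em : ∀ {ℓ} → ExcludedMiddle ℓ) (zorn : ∀ {c ℓ₁ ℓ₂} → ZornsLemma c ℓ₁ ℓ₂)
    (A : PavelkaAlgebra c ℓ) where
  open PavelkaAlgebra A
  open MVProperties mvAlgebra

  maximal-extension : {F : Pred Carrier (c ⊔ ℓ)} → IsProperFilter A F →
                      Σ[ M ∈ SpecM A ] F ⊆ SpecM.filter M
  maximal-extension {F} F-proper =
    let (M , F⊆M , M-proper) , M-maximal = zorn extensions upperBound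
    in record
      { filter         = M
      ; isProperFilter = M-proper
      ; maximal        = λ {G} G-proper M⊆G →
          -- Equality in the poset is mutual inclusion; its second half is the inclusion of `G` in
          -- `M`.
          proj₂ (M-maximal {G , (λ {x} x∈F → M⊆G (F⊆M x∈F)) , G-proper} M⊆G)
      } , F⊆M
    where
    Extension : Set (suc (c ⊔ ℓ))
    Extension = Σ[ G ∈ Pred Carrier (c ⊔ ℓ) ] F ⊆ G × IsProperFilter A G

    extensions : Poset (suc (c ⊔ ℓ)) (c ⊔ ℓ) (c ⊔ ℓ)
    extensions = record
      { Carrier        = Extension
      ; _≈_            = λ G H → proj₁ G ⊆ proj₁ H × proj₁ H ⊆ proj₁ G
      ; _≤_            = λ G H → proj₁ G ⊆ proj₁ H
      ; isPartialOrder = record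
        { isPreorder = record
          { isEquivalence = record
            { refl  = id , id
            ; sym   = λ (p , q) → q , p
            ; trans = λ (p , q) (p′ , q′) → (λ x → p′ (p x)) , (λ x → q (q′ x))
            }
          ; reflexive = proj₁
          ; trans     = λ p q x → q (p x)
          }
        ; antisym    = _,_
        }
      }

    module _ (C : Pred Extension (suc (c ⊔ ℓ)))
        (chain : ∀ {G H} → G ∈ C → H ∈ C → proj₁ G ⊆ proj₁ H ⊎ proj₁ H ⊆ proj₁ G) where

      -- Adding F keeps the union nonempty when the chain is empty.
      C∪F : Pred Extension (suc (c ⊔ ℓ))
      C∪F G = G ∈ C ⊎ Lift (suc (c ⊔ ℓ)) (proj₁ G ⊆ F)

      chain∪F : ∀ {G H} → G ∈ C∪F → H ∈ C∪F → proj₁ G ⊆ proj₁ H ⊎ proj₁ H ⊆ proj₁ G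
      chain∪F (inj₁ G∈C) (inj₁ H∈C) = chain G∈C H∈C
      chain∪F {H = H} (inj₂ (lift G⊆F)) _ = inj₁ λ x∈G → proj₁ (proj₂ H) (G⊆F x∈G)
      chain∪F {G = G} _ (inj₂ (lift H⊆F)) = inj₂ λ x∈H → proj₁ (proj₂ G) (H⊆F x∈H)

      -- Deciding membership in the union lowers its universe level.
      Union : Pred Carrier (c ⊔ ℓ)
      Union x = Lift (c ⊔ ℓ) (True (em {P = ∃[ G ] G ∈ C∪F × x ∈ proj₁ G}))

      intro : ∀ {G x} → G ∈ C∪F → x ∈ proj₁ G → x ∈ Union
      intro {G} G∈ x∈G = lift (fromWitness (G , G∈ , x∈G))

      elim : ∀ {x} → x ∈ Union → ∃[ G ] G ∈ C∪F × x ∈ proj₁ G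
      elim (lift t) = toWitness t

      F⊆Union : F ⊆ Union
      F⊆Union = intro {F , (λ {x} x∈F → x∈F) , F-proper} (inj₂ (lift λ x∈F → x∈F))

      Union-isProperFilter : IsProperFilter A Union
      Union-isProperFilter = record
        { isFilter = record
          { nonempty = let x , x∈F = IsProperFilter.nonempty F-proper in x , F⊆Union x∈F
          ; upward   = λ x≤y x∈ → let G , G∈ , x∈G = elim x∈ in
              intro {G} G∈ (IsProperFilter.upward (proj₂ (proj₂ G)) x≤y x∈G)
          ; ·-closed = λ x∈ y∈ →
              let G , G∈ , x∈G = elim x∈
                  H , H∈ , y∈H = elim y∈
              in [ (λ G⊆H → intro {H} H∈
                     (IsProperFilter.·-closed (proj₂ (proj₂ H)) (G⊆H x∈G) y∈H))
                 , (λ H⊆G → intro {G} G∈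
                     (IsProperFilter.·-closed (proj₂ (proj₂ G)) x∈G (H⊆G y∈H)))
                 ] (chain∪F {G} {H} G∈ H∈)
          }
        -- A filter containing `𝟘` is everything, and `𝟘` in the union would lie in a single proper
        -- member.
        ; proper   = λ all → let G , _ , 𝟘∈G = elim (all 𝟘) in
            IsProperFilter.proper (proj₂ (proj₂ G)) λ x →
              IsProperFilter.upward (proj₂ (proj₂ G)) (𝟘≤x x) 𝟘∈G
        }

      upperBound : ∃[ U ] (∀ {G} → G ∈ C → proj₁ G ⊆ proj₁ U)
      upperBound = (Union , (λ {x} → F⊆Union {x}) , Union-isProperFilter) ,
        λ {G} G∈C → intro {G} (inj₁ G∈C)

-- Maximal filters that separate an element from the preimage of `G`.

module Separation (em : ∀ {ℓ} → ExcludedMiddle ℓ) (zorn : ∀ {c ℓ₁ ℓ₂} → ZornsLemma c ℓ₁ ℓ₂)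
    {A B : PavelkaAlgebra c ℓ}
    {f : PavelkaAlgebra.Carrier A → PavelkaAlgebra.Carrier B}
    {g : PavelkaAlgebra.Carrier B → PavelkaAlgebra.Carrier A}
    (f⇆g : IsStrongLeftAdjoint A B f g) (G : SpecM B) where
  private
    module B where
      open PavelkaAlgebra B public
      open MVProperties mvAlgebra public
      open MVOrder mvAlgebra public
    module G = SpecM G
  open PavelkaAlgebra A
  open MVProperties mvAlgebra
  open MVOrder mvAlgebra
  open IsStrongLeftAdjoint f⇆g
  open StrongLeftAdjoint f⇆g

  private
    N : Pred Carrier (c ⊔ ℓ)
    N b = f b ∈ G.filter

  -- Meets replace products here: `f` preserves `∧` but need not preserve `·`.
  N-∧ : ∀ {b b′} → b ∈ N → b′ ∈ N → b ∧ b′ ∈ N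
  N-∧ b∈N b′∈N = G.upward (f-∧ _ _) (G.upward (B.x·y≤x∧y _ _) (G.·-closed b∈N b′∈N))

  -- The hypothesis `z ⇒ y ≤ y` says that `z ∨ y` is `𝟙`. The filter `F` is a maximal one above the
  -- filter `T` generated by `z` and all `y ⇒ b` with `b ∈ N`.
  separate : ∀ {y z} → y ∉ N → z ⇒ y ≤ y →
             Σ[ F ∈ SpecM A ] z ∈ SpecM.filter F × (∀ {b} → b ∈ N → (y ⇒ b) ∈ SpecM.filter F)
  separate {y} {z} y∉N z⇒y≤y = let F , T⊆F = maximal-extension em zorn A T-isProperFilter in
    F , T⊆F (𝟙 , 𝟙∈N , 1 , ≤-trans (x·y≤x _ 𝟙) (x·y≤y _ z)) ,
    λ b∈N → T⊆F (_ , b∈N , 1 , ≤-trans (x·y≤x _ 𝟙) (x·y≤x _ z))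
    where
    u : Carrier → Carrier
    u b = (y ⇒ b) · z

    u-mono : ∀ {b b′} → b ≤ b′ → u b ≤ u b′
    u-mono b≤b′ = ·-monoˡ z (⇒-monoʳ y b≤b′)

    -- Powers of a single `u b` suffice: `u` is monotone and `N` is closed under `∧`, so
    -- `u b ^ m · u b′ ^ n` lies above `u (b ∧ b′) ^ (m + n)`.
    T : Pred Carrier (c ⊔ ℓ)
    T x = ∃[ b ] b ∈ N × ∃[ n ] u b ^ n ≤ x

    𝟙∈N : 𝟙 ∈ N
    𝟙∈N = G.upward f-𝟙 (FilterProperties.𝟙∈ B G.isFilter)

    -- This says that `u b ∨ (b ⇒ y)` is `𝟙`, which holds for each factor of `u b`: for `z` by
    -- hypothesis, for `y ⇒ b` by prelinearity. In this form it passes to powers of `u b`.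
    u⇒≤ : ∀ b → u b ⇒ b ⇒ y ≤ b ⇒ y
    u⇒≤ b = ≤-trans (≤-reflexive (curry (y ⇒ b) z (b ⇒ y)))
      (≤-trans (⇒-monoʳ (y ⇒ b) (≤-trans (≤-reflexive (exchange z b y)) (⇒-monoʳ b z⇒y≤y)))
        (prelinearity y b))

    T-isProperFilter : IsProperFilter A T
    T-isProperFilter = record
      { isFilter = record
        { nonempty = 𝟙 , 𝟙 , 𝟙∈N , 0 , ≤-refl
        ; upward   = λ { x≤x′ (b , b∈N , n , uⁿ≤x) → b , b∈N , n , ≤-trans uⁿ≤x x≤x′ }
        ; ·-closed = λ { (b , b∈N , m , uᵐ≤x) (b′ , b′∈N , n , uⁿ≤x′) →
            b ∧ b′ , N-∧ b∈N b′∈N , m ℕ.+ n ,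
            ≤-trans (≤-reflexive (≈-sym (^-+ (u (b ∧ b′)) m n))) (·-mono
              (≤-trans (^-mono m (u-mono (∧-lowerˡ b b′))) uᵐ≤x)
              (≤-trans (^-mono n (u-mono (∧-lowerʳ b b′))) uⁿ≤x′)) }
        }
      -- If `u b ^ n` is `𝟘`, then `u b ^ n ⇒ b ⇒ y` is `𝟙`, so `^-prelinear` gives `b ≤ y`, and `y`
      -- would lie in the up-set `N`.
      ; proper   = λ all → let b , b∈N , n , uⁿ≤𝟘 = all 𝟘 in y∉N (G.upward (f-monotone
          (≤-antisym (x≤𝟙 _)
            (≤-trans (≤-reflexive (≈-sym (≤-trans uⁿ≤𝟘 (𝟘≤x (b ⇒ y)))))
              (^-prelinear n (u⇒≤ b))))) b∈N)
      }

-- Residuation in the standard algebra, ordered by inclusion of cuts.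

module UnitIntervalProperties (em : ∀ {ℓ} → ExcludedMiddle ℓ) (ℓ : Level) where
  open Classical em public
  open PavelkaAlgebra (unitInterval ℓ) using (mvAlgebra)
  open MVProperties mvAlgebra public

  ⇒ᵁ-monoʳ : ∀ {x y} (z : UnitInterval ℓ) → x ⊑ y → z ⇒ᵁ x ⊑ z ⇒ᵁ y
  ⇒ᵁ-monoʳ {x} {y} z = ⊕ᵁ-mono {x = ∼ᵁ z} {∼ᵁ z} {x} {y} id

  ⇒ᵁ-antiˡ : ∀ {x y} (z : UnitInterval ℓ) → x ⊑ y → y ⇒ᵁ z ⊑ x ⇒ᵁ z
  ⇒ᵁ-antiˡ {x} {y} z x⊑y =
    ⊕ᵁ-mono {x = ∼ᵁ y} {∼ᵁ x} {z} {z} (∼ᵁ-anti {x = x} {y} x⊑y) id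

  ·ᵁ-monoʳ : ∀ {x y} (z : UnitInterval ℓ) → x ⊑ y → z ·ᵁ x ⊑ z ·ᵁ y
  ·ᵁ-monoʳ {x} {y} z x⊑y = ∼ᵁ-anti {x = ∼ᵁ z ⊕ᵁ ∼ᵁ y} {∼ᵁ z ⊕ᵁ ∼ᵁ x}
    (⇒ᵁ-monoʳ {∼ᵁ y} {∼ᵁ x} z (∼ᵁ-anti {x = x} {y} x⊑y))

  residualᵁ : ∀ x y z → x ·ᵁ y ⊑ z → x ⊑ y ⇒ᵁ z
  residualᵁ x y z xy⊑z = ≤⇒⊑ {x = x} {y ⇒ᵁ z}
    (residual {x} {y} {z} (⊑⇒≤ {x = x ·ᵁ y} {z} xy⊑z))

  unresidualᵁ : ∀ x y z → x ⊑ y ⇒ᵁ z → x ·ᵁ y ⊑ z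
  unresidualᵁ x y z x⊑y⇒z = ≤⇒⊑ {x = x ·ᵁ y} {z}
    (unresidual {x} {y} {z} (⊑⇒≤ {x = x} {y ⇒ᵁ z} x⊑y⇒z))

  ⇒ᵁ-swap : ∀ x y z → x ⊑ y ⇒ᵁ z → y ⊑ x ⇒ᵁ z
  ⇒ᵁ-swap x y z x⊑y⇒z = residualᵁ y x z
    (unresidualᵁ x y z x⊑y⇒z ∘ ≈⇒⊑ (·-comm y x))

  ∼ᵁ-cancel : (x y : UnitInterval ℓ) → ∼ᵁ y ⊑ ∼ᵁ x → x ⊑ y
  ∼ᵁ-cancel x y ∼y⊑∼x =
    ≈⇒⊑ (∼ᵁ-involutive y) ∘ ∼ᵁ-anti {x = ∼ᵁ y} {∼ᵁ x} ∼y⊑∼x ∘ ≈⇒⊒ (∼ᵁ-involutive x)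

-- Fuzzy relations and the adjunction between powers of the unit interval.

module _ {I J : Set ℓ} (R : I → J → UnitInterval ℓ) where

  f[]-lower : ∀ x i j → f[ R ] x j ⊑ R i j ⇒ᵁ x i
  f[]-lower x i j = ⋀-lower (λ i → R i j ⇒ᵁ x i) i

  f[]-greatest : ∀ x j (y : UnitInterval ℓ) → (∀ i → y ⊑ R i j ⇒ᵁ x i) → y ⊑ f[ R ] x j
  f[]-greatest x j = ⋀-greatest λ i → R i j ⇒ᵁ x i

  g[]-upper : ∀ y i j → R i j ·ᵁ y j ⊑ g[ R ] y i
  g[]-upper y i j = ⋁-upper (λ j → R i j ·ᵁ y j) j

  g[]-least : ∀ y i (x : UnitInterval ℓ) → (∀ j → R i j ·ᵁ y j ⊑ x) → g[ R ] y i ⊑ x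
  g[]-least y i = ⋁-least λ j → R i j ·ᵁ y j

-- Both sides of the adjunction say that `R i j ·ᵁ x j ⊑ y i` for all `i` and `j`. The law `strong`
-- holds because `⟦ r ⟧ ⇒ᵁ_` commutes with infima and with `R i j ⇒ᵁ_`.
powers-adjoint : (em : ∀ {ℓ} → ExcludedMiddle ℓ) {I J : Set ℓ} (R : I → J → UnitInterval ℓ) →
  IsStrongLeftAdjoint (Classical.[0,1]^_ em I) (Classical.[0,1]^_ em J) f[ R ] g[ R ]
powers-adjoint {ℓ} em R = record
  { f-monotone = λ {x} {y} x≤y j → ⊑⇒≤ {x = f[ R ] x j} {f[ R ] y j}
      (f[]-greatest R y j (f[ R ] x j) λ i →
        ⇒ᵁ-monoʳ {x i} {y i} (R i j) (≤⇒⊑ {x = x i} {y i} (x≤y i)) ∘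
        f[]-lower R x i j)
  ; g-monotone = λ {x} {y} x≤y i → ⊑⇒≤ {x = g[ R ] x i} {g[ R ] y i}
      (g[]-least R x i (g[ R ] y i) λ j →
        g[]-upper R y i j ∘
        ·ᵁ-monoʳ {x j} {y j} (R i j) (≤⇒⊑ {x = x j} {y j} (x≤y j)))
  ; adjoint    = λ x y → mk⇔
      (λ x≤fy i → ⊑⇒≤ {x = g[ R ] x i} {y i} (g[]-least R x i (y i) λ j →
        unresidualᵁ (R i j) (x j) (y i) (⇒ᵁ-swap (x j) (R i j) (y i)
          (f[]-lower R y i j ∘ ≤⇒⊑ {x = x j} {f[ R ] y j} (x≤fy j)))))
      (λ gx≤y j → ⊑⇒≤ {x = x j} {f[ R ] y j} (f[]-greatest R y j (x j) λ i →
        ⇒ᵁ-swap (R i j) (x j) (y i) (residualᵁ (R i j) (x j) (y i)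
          (≤⇒⊑ {x = g[ R ] x i} {y i} (gx≤y i) ∘ g[]-upper R x i j))))
  ; strong     = λ r x j →
      let h = f[ R ] x j
          k = f[ R ] (λ i → ⟦ r ⟧ ⇒ᵁ x i) j
      in ⊑-antisym
        (f[]-greatest R (λ i → ⟦ r ⟧ ⇒ᵁ x i) j (⟦ r ⟧ ⇒ᵁ h) λ i →
          ≈⇒⊑ (exchange ⟦ r ⟧ (R i j) (x i)) ∘
          ⇒ᵁ-monoʳ {h} {R i j ⇒ᵁ x i} ⟦ r ⟧ (f[]-lower R x i j))
        (residualᵁ k ⟦ r ⟧ h (f[]-greatest R x j (k ·ᵁ ⟦ r ⟧) λ i →
          unresidualᵁ k ⟦ r ⟧ (R i j ⇒ᵁ x i)
            (≈⇒⊑ (exchange (R i j) ⟦ r ⟧ (x i)) ∘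
             f[]-lower R (λ i → ⟦ r ⟧ ⇒ᵁ x i) i j)))
  }
  where open UnitIntervalProperties em ℓ

-- The induced relation and the representation of `f`.

-- The largest `R` with `natural B (f x) G ⊑ f[ R ] (natural A x) G` for all `x` and `G`.
relation : (A B : PavelkaAlgebra c ℓ) →
  (PavelkaAlgebra.Carrier A → PavelkaAlgebra.Carrier B) →
  SpecM A → SpecM B → UnitInterval (suc (c ⊔ ℓ))
relation A B f F G = ⋀ λ x → natural B (f x) G ⇒ᵁ natural A x F

module ValueProperties (em : ∀ {ℓ} → ExcludedMiddle ℓ) (A : PavelkaAlgebra c ℓ) (F : SpecM A) where
  open PavelkaAlgebra A
  open UnitIntervalProperties em (suc (c ⊔ ℓ)) using (≈-trans; ⊕-congʳ)
  open Hölder em A F public using (v-mono; v-const; v-∼; v-⊕)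
  open FilterProperties A (SpecM.isFilter F) using (≤⇒≼)

  value-mono : ∀ {x y} → x ≤ y → value A F x ⊑ value A F y
  value-mono {x} {y} x≤y = v-mono {x} {y} (≤⇒≼ x≤y)

  value-⇒ : ∀ x y → value A F (x ⇒ y) ≈ᵁ value A F x ⇒ᵁ value A F y
  value-⇒ x y = ≈-trans (v-⊕ (∼ x) y) (⊕-congʳ (v-∼ x))

module Representation (em : ∀ {ℓ} → ExcludedMiddle ℓ) (zorn : ∀ {c ℓ₁ ℓ₂} → ZornsLemma c ℓ₁ ℓ₂)
    {A B : PavelkaAlgebra c ℓ}
    {f : PavelkaAlgebra.Carrier A → PavelkaAlgebra.Carrier B}
    {g : PavelkaAlgebra.Carrier B → PavelkaAlgebra.Carrier A}
    (f⇆g : IsStrongLeftAdjoint A B f g) where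
  private
    module B where
      open PavelkaAlgebra B public
      open MVProperties mvAlgebra public
    R = relation A B f
  open PavelkaAlgebra A
  open MVProperties mvAlgebra
  open MVOrder mvAlgebra
  open IsMVAlgebra isMVAlgebra using (∨-comm)
  open IsStrongLeftAdjoint f⇆g
  open StrongLeftAdjoint f⇆g using (unit)
  open UnitIntervalProperties em (suc (c ⊔ ℓ)) using (stable; ⇒ᵁ-monoʳ; ⇒ᵁ-antiˡ; ⇒ᵁ-swap; unresidualᵁ)

  relation-lower : ∀ x F G → R F G ⊑ natural B (f x) G ⇒ᵁ natural A x F
  relation-lower x F G = ⋀-lower (λ x → natural B (f x) G ⇒ᵁ natural A x F) x

  relation-greatest : ∀ F G (z : UnitInterval (suc (c ⊔ ℓ))) →
    (∀ x → z ⊑ natural B (f x) G ⇒ᵁ natural A x F) → z ⊑ R F G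
  relation-greatest F G = ⋀-greatest λ x → natural B (f x) G ⇒ᵁ natural A x F

  natural-f-⊑ : ∀ x G → natural B (f x) G ⊑ f[ R ] (natural A x) G
  natural-f-⊑ x G = f[]-greatest R (natural A x) G (natural B (f x) G) λ F →
    ⇒ᵁ-swap (R F G) (natural B (f x) G) (natural A x F) (relation-lower x F G)

  natural-f-⊒ : ∀ x G → f[ R ] (natural A x) G ⊑ natural B (f x) G
  -- Negative rationals lie in every cut; the others lead to a constant `r` of the algebra.
  natural-f-⊒ x G {q} q◁ with q ℚ.<? 0ℚ
  ... | yes q<0 = 0≤ (natural B (f x) G) q<0
  ... | no  q≮0 = stable λ q⋪ → go q⋪ (rounded (f[ R ] (natural A x) G) q◁)
    where
    module G = SpecM G

    go : ¬ q ◁ natural B (f x) G → ¬ (∃[ s ] q ℚ.< s × s ◁ f[ R ] (natural A x) G)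
    -- The rational `s` lies in a cut bounded by `⟦ r ⟧`, where `r` is `s` itself, so `s < s`.
    go q⋪ (s , q<s , s◁) = ℚ.<-irrefl refl (lower (f[R]x⊑r s◁))
      where
      r : ℚ₀₁
      r = s , ℚ.<⇒≤ (ℚ.≤-<-trans (ℚ.≮⇒≥ q≮0) q<s) , ℚ.<⇒≤ (≤1 (f[ R ] (natural A x) G) s◁)

      y = const r ⇒ x

      fy∉G : f y ∉ G.filter
      -- By `strong`, `f y` is `r ⇒ f x`; its membership in `G` would put `q < r` below `f x / G`.
      fy∉G fy∈G = q⋪ (lift (r , q<s , G.upward (B.≤-reflexive (B.≈-sym (strong r x))) fy∈G))

      separation = Separation.separate em zorn f⇆g G {y} {x ⇒ const r} fy∉G
        (prelinearity x (const r))
      F = proj₁ separation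
      x≼r = proj₁ (proj₂ separation)
      y≼N = proj₂ (proj₂ separation)
      module F = SpecM F
      open ValueProperties em A F

      -- If `t ≤ f a` modulo `G`, then `t ⇒ a` lies in `N`, so `y ⇒ t ⇒ a` lies in `F`; exchanging
      -- premises gives `t ≤ y ⇒ a` modulo `F`.
      y⊑R : value A F y ⊑ R F G
      y⊑R = relation-greatest F G (value A F y) λ a →
        ⇒ᵁ-swap (natural B (f a) G) (value A F y) (value A F a)
          (≈⇒⊑ (value-⇒ y a) ∘ λ (lift (t , p<t , t≼fa)) → lift (t , p<t ,
            F.upward (≤-reflexive (exchange y (const t) a))
              (y≼N (G.upward (B.≤-reflexive (strong t a)) t≼fa))))

      -- Here `y ⇒ x` is `r ∨ x`, while `(x ⇒ r) ∨ r` unfolds to `(x ∨ r) ⇒ r`.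
      y⇒x≼r : ((y ⇒ x) ⇒ const r) ∈ F.filter
      y⇒x≼r = F.upward (≤-trans (x≤x∨y (x ⇒ const r) (const r))
        (⇒-antiˡ (const r) (≤-reflexive (∨-comm (const r) x)))) x≼r

      f[R]x⊑r : f[ R ] (natural A x) G ⊑ ⟦ r ⟧
      f[R]x⊑r =
          ≈⇒⊑ (v-const r)
        ∘ v-mono {y ⇒ x} {const r} y⇒x≼r
        ∘ ≈⇒⊒ (value-⇒ y x)
        ∘ ⇒ᵁ-antiˡ {value A F y} {R F G} (value A F x) y⊑R
        ∘ f[]-lower R (natural A x) F G

  -- The infimum defining `R F G` is taken at `g y`, and `y ≤ f (g y)` by the unit.
  natural-g-⊒ : ∀ y F → g[ R ] (natural B y) F ⊑ natural A (g y) F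
  natural-g-⊒ y F = g[]-least R (natural B y) F (natural A (g y) F) λ G →
    unresidualᵁ (R F G) (natural B y G) (natural A (g y) F)
      ( ⇒ᵁ-antiˡ {natural B y G} {natural B (f (g y)) G} (natural A (g y) F)
          (ValueProperties.value-mono em B G (unit y))
      ∘ relation-lower (g y) F G)

-- The representation of `g` by duality.

module DualRepresentation (em : ∀ {ℓ} → ExcludedMiddle ℓ)
    (zorn : ∀ {c ℓ₁ ℓ₂} → ZornsLemma c ℓ₁ ℓ₂)
    {A B : PavelkaAlgebra c ℓ}
    {f : PavelkaAlgebra.Carrier A → PavelkaAlgebra.Carrier B}
    {g : PavelkaAlgebra.Carrier B → PavelkaAlgebra.Carrier A}
    (f⇆g : IsStrongLeftAdjoint A B f g) where
  private
    module A where
      open PavelkaAlgebra A public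
      open MVProperties mvAlgebra public
      open MVOrder mvAlgebra public
      open IsMVAlgebra isMVAlgebra public using (∼-cong; ∼-involutive)
    module B where
      open PavelkaAlgebra B public
      open MVProperties mvAlgebra public
      open IsMVAlgebra isMVAlgebra public using (∼-involutive)
    g° : B.Carrier → A.Carrier
    g° y = A.∼ g (B.∼ y)
    R = relation A B f
    R° = relation B A g°
  open StrongLeftAdjoint f⇆g
  open UnitIntervalProperties em (suc (c ⊔ ℓ)) hiding (_^_)

  -- Taking the infimum for `R°` at `∼ f x` and using `∼ x ≤ g° (∼ f x)`, from the counit, bounds it
  -- by `∼ x / F → ∼ f x / G`, the contrapositive of the term of `R` at `x`.
  relation-dual : ∀ F G → R° G F ⊑ R F G
  relation-dual F G = Representation.relation-greatest em zorn f⇆g F G (R° G F) λ x →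
    let v = natural A x F
        w = natural B (f x) G
    in
      ≈⇒⊑ (contraposition w v)
    ∘ ⇒ᵁ-monoʳ {natural B (B.∼ f x) G} {∼ᵁ w} (∼ᵁ v) (≈⇒⊑ (VB.v-∼ G (f x)))
    ∘ ⇒ᵁ-antiˡ {∼ᵁ v} {natural A (g° (B.∼ f x)) F} (natural B (B.∼ f x) G)
        ( VA.value-mono F (A.∼-anti (A.≤-trans
            (A.≤-reflexive (g-cong (B.∼-involutive (f x)))) (counit x)))
        ∘ ≈⇒⊒ (VA.v-∼ F x))
    ∘ Representation.relation-lower em zorn dual (B.∼ f x) G F
    where
    module VA = ValueProperties em A
    module VB = ValueProperties em B

  -- After negation the claim concerns `g° (∼ y)`, so the hard half of the representation applies to
  -- the dual adjoint. It remains to bound `∼ᵁ h` by each term of the infimum for `R°`.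
  natural-g-⊑ : ∀ y F → natural A (g y) F ⊑ g[ R ] (natural B y) F
  natural-g-⊑ y F = ∼ᵁ-cancel (natural A (g y) F) h
    ( ≈⇒⊑ (VA.v-∼ F (g y))
    ∘ VA.value-mono F (A.≤-reflexive (A.∼-cong (g-cong (B.∼-involutive y))))
    ∘ Representation.natural-f-⊒ em zorn dual (B.∼ y) F
    ∘ f[]-greatest R° (natural B (B.∼ y)) F (∼ᵁ h) λ G →
        let v = natural B y G
            v∼ = natural B (B.∼ y) G
        in
          ⇒ᵁ-monoʳ {∼ᵁ v} {v∼} (R° G F) (≈⇒⊒ (VB.v-∼ G y))
        -- Implication is antitone in its premise, so the bound for `R` carries over to the smaller
        -- `R°`.
        ∘ ⇒ᵁ-antiˡ {R° G F} {R F G} (∼ᵁ v) (relation-dual F G)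
        ∘ ≈⇒⊑ (∼ᵁ-involutive (R F G ⇒ᵁ ∼ᵁ v))
        ∘ ∼ᵁ-anti {x = R F G ·ᵁ v} {h} (g[]-upper R (natural B y) F G))
    where
    module VA = ValueProperties em A
    module VB = ValueProperties em B
    h = g[ R ] (natural B y) F

theorem6 : (a c ℓ : Level) →
    (em : ∀ {ℓ′} → ExcludedMiddle ℓ′) →
    (zorn : ∀ {c′ ℓ₁ ℓ₂} → ZornsLemma c′ ℓ₁ ℓ₂) →
    ( (I J : Set a) (R : I → J → UnitInterval a) →
    IsStrongLeftAdjoint (Classical.[0,1]^_ em I) (Classical.[0,1]^_ em J) f[ R ] g[ R ] )
    ×
    ( (A B : PavelkaAlgebra c ℓ) → Semisimple A → Semisimple B →
    (f : PavelkaAlgebra.Carrier A → PavelkaAlgebra.Carrier B) →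
    (g : PavelkaAlgebra.Carrier B → PavelkaAlgebra.Carrier A) →
    IsStrongLeftAdjoint A B f g →
    Σ[ R ∈ (SpecM A → SpecM B → UnitInterval (suc (c ⊔ ℓ))) ]
    ( (∀ F G → R F G ≈ᵁ ⋀ (λ x → natural B (f x) G ⇒ᵁ natural A x F))
    × (∀ x G → natural B (f x) G ≈ᵁ f[ R ] (natural A x) G)
    × (∀ y F → natural A (g y) F ≈ᵁ g[ R ] (natural B y) F) ) )
theorem6 a c ℓ em zorn =
    (λ I J R → powers-adjoint em R)
  , λ A B _ _ f g f⇆g →
      let module P = Representation em zorn f⇆g
          module D = DualRepresentation em zorn f⇆g
      in relation A B f
       , (λ F G → IsEquivalence.refl ≈ᵁ-isEquivalence)
       , (λ x G → ⊑-antisym (P.natural-f-⊑ x G) (P.natural-f-⊒ x G))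
       , (λ y F → ⊑-antisym (D.natural-g-⊑ y F) (P.natural-g-⊒ y F))
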